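{- Let $Q$ and $\tilde Q$ be connected loop-less quivers with the same number $m$ of vertices and the same number $n$ of arrows. The following are equivalent: (i) $\Lambda_Q=\Lambda_{\tilde Q}$; (ii) there is an $n\times n$ integer matrix $B$ (not necessarily $\mathbb{Z}$-invertible) with $I(Q)B=I(\tilde Q)$ and $I(\tilde Q^{\dagger})B^{\mathrm{tr}}=I(Q^{\dagger})$; (iii) there is an $n\times n$ integer matrix $B$ (necessarily $\mathbb{Z}$-invertible) with $I(Q)B=I(\tilde Q)$ and $\check G_{\tilde Q}=B^{\mathrm{tr}}\check G_QB$.
   Context: A quiver $Q$ has vertex set $\{1,\dots,m\}$, arrow set $\{1,\dots,n\}$ and maps $s,t$ (source, target); it is loop-less if $s(i)\ne t(i)$ for all arrows $i$, connected if its underlying graph is connected. The incidence matrix $I(Q)$ is the $m\times n$ integer matrix whose $i$-th column is $\mathbf{e}_{s(i)}-\mathbf{e}_{t(i)}$. Let $G_Q=I(Q)^{\mathrm{tr}}I(Q)$ and $\check G_Q$ the unique upper triangular matrix with $\check G_Q+\check G_Q^{\mathrm{tr}}=G_Q$ (it has ones on the diagonal when $Q$ is loop-less). The inverse quiver $Q^\dagger$ of a connected loop-less quiver $Q$ is the quiver on the same vertices and arrows with incidence matrix $I(Q^\dagger)=I(Q)\check G_Q^{ -1}$ (this matrix is known to be the incidence matrix of a connected loop-less quiver). The Coxeter–Laplacian of $Q$ is $\Lambda_Q=\mathrm{Id}_m-I(Q)\check G_Q^{ -1}I(Q)^{\mathrm{tr}}$. -}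

module Defs where

open import Data.Nat using (ℕ; zero; suc)
open import Data.Fin using (Fin; zero; suc; _<_)
open import Data.Integer using (ℤ; +_; _+_; _-_; _*_; -_)
open import Data.Integer.DivMod using (_/ℕ_)
open import Data.Product using (∃; _×_)
open import Relation.Binary.PropositionalEquality using (_≡_; _≢_)
open import Relation.Binary.Construct.Closure.Equivalence using (EqClosure)
open import Relation.Nullary using (yes; no)
open import Data.Fin using (_≟_; _<?_)

Mat : ℕ → ℕ → Set
Mat m n = Fin m → Fin n → ℤ

∑ : ∀ n → (Fin n → ℤ) → ℤ
∑ zero    f = + 0
∑ (suc n) f = f zero + ∑ n (λ i → f (suc i))

_⊗_ : ∀ {m k n} → Mat m k → Mat k n → Mat m n
_⊗_ {k = k} A B i j = ∑ k (λ l → A i l * B l j)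

infixl 7 _⊗_

_ᵀ : ∀ {m n} → Mat m n → Mat n m
(A ᵀ) i j = A j i

Id : ∀ n → Mat n n
Id n i j with i ≟ j
... | yes _ = + 1
... | no  _ = + 0

_⊖_ : ∀ {m n} → Mat m n → Mat m n → Mat m n
(A ⊖ B) i j = A i j - B i j

_≐_ : ∀ {m n} → Mat m n → Mat m n → Set
A ≐ B = ∀ i j → A i j ≡ B i j

infix 4 _≐_

_^^_ : ∀ {n} → Mat n n → ℕ → Mat n n
_^^_ {n} A zero    = Id n
_^^_ {n} A (suc k) = A ⊗ (A ^^ k)

-- Inverse of an upper unitriangular n×n matrix U = Id + N (N nilpotent,
-- N^n = 0):  U⁻¹ = Σ_{k<n} (Id - U)^k.
∑M : ∀ {n} → ℕ → (ℕ → Mat n n) → Mat n n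
∑M zero    F i j = + 0
∑M (suc k) F i j = F k i j + ∑M k F i j

unitriInv : ∀ {n} → Mat n n → Mat n n
unitriInv {n} U = ∑M n (λ k → (Id n ⊖ U) ^^ k)

record Quiver (m n : ℕ) : Set where
  field
    s : Fin n → Fin m
    t : Fin n → Fin m
open Quiver public

Loopless : ∀ {m n} → Quiver m n → Set
Loopless Q = ∀ i → s Q i ≢ t Q i

Adj : ∀ {m n} → Quiver m n → Fin m → Fin m → Set
Adj Q u v = ∃ λ i → s Q i ≡ u × t Q i ≡ v

Connected : ∀ {m n} → Quiver m n → Set
Connected {m} Q = ∀ (u v : Fin m) → EqClosure (Adj Q) u v

Inc : ∀ {m n} → Quiver m n → Mat m n
Inc {m} Q v i = Id m v (s Q i) - Id m v (t Q i)

Gram : ∀ {m n} → Quiver m n → Mat n n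
Gram Q = (Inc Q ᵀ) ⊗ Inc Q

-- Ǧ_Q: the upper triangular matrix with Ǧ + Ǧᵀ = G
Gˇ : ∀ {m n} → Quiver m n → Mat n n
Gˇ Q i j with i ≟ j
... | yes _ = Gram Q i j /ℕ 2
... | no  _ with i <? j
...   | yes _ = Gram Q i j
...   | no  _ = + 0

-- incidence matrix of the inverse quiver Q†: I(Q) Ǧ_Q⁻¹
Inc† : ∀ {m n} → Quiver m n → Mat m n
Inc† Q = Inc Q ⊗ unitriInv (Gˇ Q)

Λ : ∀ {m n} → Quiver m n → Mat m m
Λ {m} Q = Id m ⊖ (Inc Q ⊗ unitriInv (Gˇ Q) ⊗ (Inc Q ᵀ))

{-# OPTIONS --safe #-}
-- Reading the arrows of Q as transpositions (s(i) t(i)), the Coxeter–Laplacian is the matrix of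
-- the permutation obtained as their ordered product: prefixing an arrow with vector x multiplies
-- Λ on the left by the reflection Id - x xᵀ.  A braid move (x , y) ↦ (x y x⁻¹ , x) or a reversal
-- of an arrow changes (I , Ǧ) by a congruence as in (iii).  By the transitivity theorem of
-- Hurwitz, two transitive factorisations of a permutation into equally many transpositions differ
-- by braid moves, hence (i) implies (iii).  It is proved by induction on the number of vertices:
-- the arrows at the vertex 0 can be gathered in front as copies of one transposition (0 a), whose
-- number is then lowered to one or two; that number and a (if there is only one copy) are read off
-- from the permutation, and a is arbitrary if there are two.
-- A matrix B as in (iii) has a left inverse, hence is invertible, and this gives (ii); and (ii)
-- gives (i) because I(Q†) I(Q)ᵀ = I(Q̃†) Bᵀ I(Q)ᵀ = I(Q̃†) I(Q̃)ᵀ.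
module Submission where

open import Defs
open import Data.Bool using (Bool; true; false)
open import Data.Fin using (Fin; zero; suc; toℕ; _≟_; _<?_; punchIn; punchOut)
import Data.Fin.Properties as Finₚ
open import Data.Integer using (ℤ; _+_; _-_; _*_; -_; 0ℤ; 1ℤ; ≢-nonZero)
open import Data.Integer.DivMod using (_/ℕ_)
open import Data.Integer.Properties using (+-identityˡ; +-identityʳ; *-zeroˡ; *-zeroʳ; *-identityˡ; *-identityʳ; *-comm; *-assoc; *-distribˡ-+; *-cancelʳ-≡; i*j≡0⇒i≡0∨j≡0)
import Data.Integer.Properties as ℤₚ
open import Data.Integer.Tactic.RingSolver using (solve-∀)
open import Data.Nat as ℕ using (ℕ; zero; suc)
import Data.Nat.Properties as ℕₚ
open import Data.Product using (Σ; ∃; _×_; _,_; proj₁; proj₂)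
open import Data.Sum using (inj₁; inj₂)
open import Data.Vec using (Vec; []; _∷_; lookup; map; tabulate)
open import Data.Vec.Properties using (lookup∘tabulate)
open import Data.Vec.Relation.Unary.All as All using (All; []; _∷_)
import Data.Vec.Relation.Unary.All.Properties as Allₚ
open import Function using (_∘_)
open import Function.Bundles using (_⇔_; mk⇔)
open import Level using (0ℓ)
open import Relation.Binary.Bundles using (Setoid)
import Relation.Binary.Construct.Closure.Equivalence as EqClosure
import Relation.Binary.Construct.On as On
open import Relation.Binary.Core using (Rel)
open import Relation.Binary.PropositionalEquality using (_≡_; _≢_; refl; sym; trans; cong; cong₂; subst; isEquivalence; module ≡-Reasoning)
import Relation.Binary.Reasoning.Setoid as SetoidReasoning
open import Relation.Binary.Structures using (IsEquivalence)
open import Relation.Nullary using (¬_; Dec; yes; no; contradiction)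
open import Relation.Nullary.Decidable using (¬?; decidable-stable)

private
  variable
    k l m n : ℕ

-- Integer matrices

∑-cong : ∀ n {f g : Fin n → ℤ} → (∀ i → f i ≡ g i) → ∑ n f ≡ ∑ n g
∑-cong zero    f≗g = refl
∑-cong (suc n) f≗g = cong₂ _+_ (f≗g zero) (∑-cong n (f≗g ∘ suc))

∑-zero : ∀ n {f : Fin n → ℤ} → (∀ i → f i ≡ 0ℤ) → ∑ n f ≡ 0ℤ
∑-zero zero    f≗0 = refl
∑-zero (suc n) f≗0 = cong₂ _+_ (f≗0 zero) (∑-zero n (f≗0 ∘ suc))

∑-distrib-+ : ∀ n (f g : Fin n → ℤ) → ∑ n (λ i → f i + g i) ≡ ∑ n f + ∑ n g
∑-distrib-+ zero    f g = refl
∑-distrib-+ (suc n) f g =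
  trans (cong (λ z → f zero + g zero + z) (∑-distrib-+ n (f ∘ suc) (g ∘ suc)))
        (interchange (f zero) (g zero) (∑ n (f ∘ suc)) (∑ n (g ∘ suc)))
  where
  interchange : ∀ a b c d → a + b + (c + d) ≡ a + c + (b + d)
  interchange = solve-∀

∑-*ˡ : ∀ n c (f : Fin n → ℤ) → ∑ n (λ i → c * f i) ≡ c * ∑ n f
∑-*ˡ zero    c f = sym (*-zeroʳ c)
∑-*ˡ (suc n) c f =
  trans (cong ((c * f zero) +_) (∑-*ˡ n c (f ∘ suc))) (sym (*-distribˡ-+ c (f zero) _))

∑-*ʳ : ∀ n c (f : Fin n → ℤ) → ∑ n (λ i → f i * c) ≡ ∑ n f * c
∑-*ʳ n c f = trans (∑-cong n (λ i → *-comm (f i) c)) (trans (∑-*ˡ n c f) (*-comm c _))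

∑-swap : ∀ m n (f : Fin m → Fin n → ℤ) →
         ∑ m (λ i → ∑ n (f i)) ≡ ∑ n (λ j → ∑ m (λ i → f i j))
∑-swap zero    n f = sym (∑-zero n (λ _ → refl))
∑-swap (suc m) n f =
  trans (cong (∑ n (f zero) +_) (∑-swap m n (f ∘ suc)))
        (sym (∑-distrib-+ n (f zero) (λ j → ∑ m (λ i → f (suc i) j))))

≐-setoid : ℕ → ℕ → Setoid _ _
≐-setoid m n = record
  { Carrier = Mat m n
  ; _≈_ = _≐_
  ; isEquivalence = record
    { refl  = λ _ _ → refl
    ; sym   = λ p i j → sym (p i j)
    ; trans = λ p q i j → trans (p i j) (q i j)
    }
  }

module ≐-Reasoning {m n} = SetoidReasoning (≐-setoid m n)

≐-sym : {A B : Mat m n} → A ≐ B → B ≐ A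
≐-sym p i j = sym (p i j)

≐-trans : {A B C : Mat m n} → A ≐ B → B ≐ C → A ≐ C
≐-trans p q i j = trans (p i j) (q i j)

⊗-cong : {A A′ : Mat m k} {B B′ : Mat k n} → A ≐ A′ → B ≐ B′ → A ⊗ B ≐ A′ ⊗ B′
⊗-cong {k = k} p q i j = ∑-cong k (λ l → cong₂ _*_ (p i l) (q l j))

⊗-congˡ : (A : Mat m k) {B B′ : Mat k n} → B ≐ B′ → A ⊗ B ≐ A ⊗ B′
⊗-congˡ A q = ⊗-cong {A = A} (λ _ _ → refl) q

⊗-congʳ : {A A′ : Mat m k} (B : Mat k n) → A ≐ A′ → A ⊗ B ≐ A′ ⊗ B
⊗-congʳ B p = ⊗-cong {B = B} p (λ _ _ → refl)

⊗-assoc : (A : Mat m k) (B : Mat k l) (C : Mat l n) → A ⊗ B ⊗ C ≐ A ⊗ (B ⊗ C)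
⊗-assoc {k = k} {l = l} A B C i j = begin
  ∑ l (λ b → ∑ k (λ a → A i a * B a b) * C b j)
    ≡⟨ ∑-cong l (λ b → sym (∑-*ʳ k (C b j) _)) ⟩
  ∑ l (λ b → ∑ k (λ a → A i a * B a b * C b j))
    ≡⟨ ∑-swap l k _ ⟩
  ∑ k (λ a → ∑ l (λ b → A i a * B a b * C b j))
    ≡⟨ ∑-cong k (λ a → trans (∑-cong l (λ b → *-assoc (A i a) (B a b) (C b j))) (∑-*ˡ l (A i a) _)) ⟩
  ∑ k (λ a → A i a * ∑ l (λ b → B a b * C b j)) ∎
  where open ≡-Reasoning

⊗-ᵀ : (A : Mat m k) (B : Mat k n) → (A ⊗ B) ᵀ ≐ B ᵀ ⊗ A ᵀ
⊗-ᵀ {k = k} A B i j = ∑-cong k (λ l → *-comm (A j l) (B l i))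

Id-refl : (i : Fin n) → Id n i i ≡ 1ℤ
Id-refl i with i ≟ i
... | yes _   = refl
... | no  i≢i = contradiction refl i≢i

Id-≢ : {i j : Fin n} → i ≢ j → Id n i j ≡ 0ℤ
Id-≢ {i = i} {j} i≢j with i ≟ j
... | yes i≡j = contradiction i≡j i≢j
... | no  _   = refl

Id-injective : {i j : Fin n} → Id n i j ≡ 1ℤ → i ≡ j
Id-injective {i = i} {j} eq with i ≟ j
... | yes i≡j = i≡j
Id-injective () | no _

Id-suc : (i j : Fin n) → Id (suc n) (suc i) (suc j) ≡ Id n i j
Id-suc i j with i ≟ j
... | yes _ = refl
... | no  _ = refl

Id-sym : (i j : Fin n) → Id n i j ≡ Id n j i
Id-sym i j with i ≟ j
... | yes refl = sym (Id-refl i)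
... | no  i≢j  = sym (Id-≢ (i≢j ∘ sym))

∑-Id : ∀ n (f : Fin n → ℤ) i → ∑ n (λ l → f l * Id n l i) ≡ f i
∑-Id (suc n) f zero =
  trans (cong₂ _+_ (*-identityʳ (f zero)) (∑-zero n (λ i → *-zeroʳ (f (suc i)))))
        (+-identityʳ (f zero))
∑-Id (suc n) f (suc i) =
  trans (cong₂ _+_ (*-zeroʳ (f zero))
          (trans (∑-cong n (λ l → cong (f (suc l) *_) (Id-suc l i))) (∑-Id n (f ∘ suc) i)))
        (+-identityˡ (f (suc i)))

⊗-identityʳ : (A : Mat m n) → A ⊗ Id n ≐ A
⊗-identityʳ {n = n} A i j = ∑-Id n (A i) j

⊗-identityˡ : (A : Mat m n) → Id m ⊗ A ≐ A
⊗-identityˡ {m = m} A i j =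
  trans (∑-cong m (λ l → trans (*-comm (Id m i l) (A l j)) (cong (A l j *_) (Id-sym i l))))
        (∑-Id m (λ l → A l j) i)

inverse-unique : {A L R : Mat n n} → L ⊗ A ≐ Id n → A ⊗ R ≐ Id n → L ≐ R
inverse-unique {n = n} {A} {L} {R} LA≐I AR≐I = begin
  L            ≈⟨ ⊗-identityʳ L ⟨
  L ⊗ Id n     ≈⟨ ⊗-congˡ L AR≐I ⟨
  L ⊗ (A ⊗ R)  ≈⟨ ⊗-assoc L A R ⟨
  L ⊗ A ⊗ R    ≈⟨ ⊗-congʳ R LA≐I ⟩
  Id n ⊗ R     ≈⟨ ⊗-identityˡ R ⟩
  R            ∎
  where open ≐-Reasoning

-- One-sided inverses of square integer matrices

-- Cross-multiplying with a pivot removes one equation and one unknown without leaving the integers;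
-- a zero first column is solved by the first unit vector.
kernel-vector : (A : Mat k n) → k ℕ.< n →
                ∃ λ (v : Fin n → ℤ) → (∃ λ i → v i ≢ 0ℤ) × (∀ r → ∑ n (λ j → A r j * v j) ≡ 0ℤ)
kernel-vector {k} {suc n} A k<1+n with Finₚ.any? (λ r → ¬? (A r zero ℤₚ.≟ 0ℤ))
kernel-vector {k} {suc n} A k<1+n | no column≡0 = v , (zero , λ ()) , Av≡0
  where
  v : Fin (suc n) → ℤ
  v zero    = 1ℤ
  v (suc _) = 0ℤ

  Av≡0 : ∀ r → ∑ (suc n) (λ j → A r j * v j) ≡ 0ℤ
  Av≡0 r = cong₂ _+_
    (trans (*-identityʳ (A r zero)) (decidable-stable (A r zero ℤₚ.≟ 0ℤ) (λ ≢0 → column≡0 (r , ≢0))))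
    (∑-zero n (λ j → *-zeroʳ (A r (suc j))))
kernel-vector {suc k} {suc n} A (ℕ.s≤s k<n) | yes (p , Ap≢0) = v , (suc i₀ , vi₀≢0) , Av≡0
  where
  -- Gaussian elimination of the first column by its pivot in row p.
  a : ℤ
  a = A p zero

  A′ : Mat k n
  A′ r j = a * A (punchIn p r) (suc j) + - (A (punchIn p r) zero * A p (suc j))

  IH : ∃ λ (v : Fin n → ℤ) → (∃ λ i → v i ≢ 0ℤ) × (∀ r → ∑ n (λ j → A′ r j * v j) ≡ 0ℤ)
  IH = kernel-vector A′ k<n

  v′ : Fin n → ℤ
  v′ = proj₁ IH

  i₀ : Fin n
  i₀ = proj₁ (proj₁ (proj₂ IH))

  dot : Fin (suc k) → ℤ
  dot r = ∑ n (λ j → A r (suc j) * v′ j)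

  -- Scaling `v′` by the pivot makes row `p` solvable over ℤ, as no division by `a` is left.
  v : Fin (suc n) → ℤ
  v zero    = - dot p
  v (suc j) = a * v′ j

  vi₀≢0 : v (suc i₀) ≢ 0ℤ
  vi₀≢0 eq with i*j≡0⇒i≡0∨j≡0 a eq
  ... | inj₁ a≡0  = Ap≢0 a≡0
  ... | inj₂ v′≡0 = proj₂ (proj₁ (proj₂ IH)) v′≡0

  Av-dot : ∀ r → ∑ (suc n) (λ j → A r j * v j) ≡ A r zero * - dot p + a * dot r
  Av-dot r = cong ((A r zero * - dot p) +_)
    (trans (∑-cong n (λ j → rearrange (A r (suc j)) a (v′ j))) (∑-*ˡ n a _))
    where
    rearrange : ∀ x y z → x * (y * z) ≡ y * (x * z)
    rearrange = solve-∀

  A′v′-dot : ∀ r → ∑ n (λ j → A′ r j * v′ j) ≡ A (punchIn p r) zero * - dot p + a * dot (punchIn p r)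
  A′v′-dot r = begin
    ∑ n (λ j → A′ r j * v′ j)
      ≡⟨ ∑-cong n (λ j → expand a (A q (suc j)) b (A p (suc j)) (v′ j)) ⟩
    ∑ n (λ j → - b * (A p (suc j) * v′ j) + a * (A q (suc j) * v′ j))
      ≡⟨ ∑-distrib-+ n _ _ ⟩
    ∑ n (λ j → - b * (A p (suc j) * v′ j)) + ∑ n (λ j → a * (A q (suc j) * v′ j))
      ≡⟨ cong₂ _+_ (∑-*ˡ n (- b) _) (∑-*ˡ n a _) ⟩
    - b * dot p + a * dot q
      ≡⟨ sign b (dot p) (a * dot q) ⟩
    b * - dot p + a * dot q ∎
    where
    open ≡-Reasoning
    q : Fin (suc k)
    q = punchIn p r
    b : ℤ
    b = A q zero
    expand : ∀ a x b y z → (a * x + - (b * y)) * z ≡ - b * (y * z) + a * (x * z)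
    expand = solve-∀
    sign : ∀ b x y → - b * x + y ≡ b * - x + y
    sign = solve-∀

  Av≡0 : ∀ r → ∑ (suc n) (λ j → A r j * v j) ≡ 0ℤ
  Av≡0 r with p ≟ r
  ... | yes refl = trans (Av-dot p) (cancel a (dot p))
    where
    cancel : ∀ x y → x * - y + x * y ≡ 0ℤ
    cancel = solve-∀
  ... | no p≢r = subst (λ r → ∑ (suc n) (λ j → A r j * v j) ≡ 0ℤ) (Finₚ.punchIn-punchOut p≢r)
    (trans (Av-dot _) (trans (sym (A′v′-dot (punchOut p≢r))) (proj₂ (proj₂ IH) (punchOut p≢r))))

-- A kernel vector of the matrix `[eᵢ∣B]`, which has one column more than rows, puts a multiple `c`
-- of eᵢ into the image of `B`, say `B ⊗ z ≐ y`. Then `L ⊗ y ≐ z`, so `B ⊗ L` fixes `y`, and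
-- cancelling `c` gives column `i`.
left⇒right-inverse : (L B : Mat n n) → L ⊗ B ≐ Id n → B ⊗ L ≐ Id n
left⇒right-inverse {n} L B LB≐I r i = column (kernel-vector [eᵢ∣B] (ℕₚ.n<1+n n))
  where
  [eᵢ∣B] : Mat n (suc n)
  [eᵢ∣B] r zero    = Id n r i
  [eᵢ∣B] r (suc j) = B r j

  column : (∃ λ (v : Fin (suc n) → ℤ) → (∃ λ i → v i ≢ 0ℤ) × (∀ r → ∑ (suc n) (λ j → [eᵢ∣B] r j * v j) ≡ 0ℤ)) →
           (B ⊗ L) r i ≡ Id n r i
  column (v , (i₀ , vi₀≢0) , Av≡0) =
    *-cancelʳ-≡ ((B ⊗ L) r i) (Id n r i) c {{≢-nonZero c≢0}} (begin
      (B ⊗ L) r i * c              ≡⟨ cong (_* c) (sym (∑-Id n ((B ⊗ L) r) i)) ⟩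
      ∑ n (λ l → (B ⊗ L) r l * Id n l i) * c ≡⟨ sym (∑-*ʳ n c _) ⟩
      ∑ n (λ l → (B ⊗ L) r l * Id n l i * c) ≡⟨ ∑-cong n (λ l → *-assoc ((B ⊗ L) r l) (Id n l i) c) ⟩
      (B ⊗ L ⊗ y) r zero           ≡⟨ BLy≐y r zero ⟩
      Id n r i * c ∎)
    where
    open ≡-Reasoning

    c : ℤ
    c = v zero

    y z : Mat n 1
    y r _ = Id n r i * c
    z r _ = - v (suc r)

    Bz≐y : B ⊗ z ≐ y
    Bz≐y r j = begin
      ∑ n (λ l → B r l * - v (suc l))   ≡⟨ ∑-cong n (λ l → negate (B r l) (v (suc l))) ⟩
      ∑ n (λ l → - 1ℤ * (B r l * v (suc l)))  ≡⟨ ∑-*ˡ n (- 1ℤ) _ ⟩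
      - 1ℤ * S                          ≡⟨ split (Id n r i * c) S ⟩
      Id n r i * c - (Id n r i * c + S) ≡⟨ cong (λ z → Id n r i * c - z) (Av≡0 r) ⟩
      Id n r i * c - 0ℤ                 ≡⟨ +-identityʳ _ ⟩
      Id n r i * c ∎
      where
      S : ℤ
      S = ∑ n (λ l → B r l * v (suc l))
      negate : ∀ x y → x * - y ≡ - 1ℤ * (x * y)
      negate = solve-∀
      split : ∀ x y → - 1ℤ * y ≡ x - (x + y)
      split = solve-∀

    Ly≐z : L ⊗ y ≐ z
    Ly≐z = ≐-trans (⊗-congˡ L (≐-sym Bz≐y))
      (≐-trans (≐-sym (⊗-assoc L B z)) (≐-trans (⊗-congʳ z LB≐I) (⊗-identityˡ z)))

    BLy≐y : B ⊗ L ⊗ y ≐ y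
    BLy≐y = ≐-trans (⊗-assoc B L y) (≐-trans (⊗-congˡ B Ly≐z) Bz≐y)

    -- If `c` vanished, so would `y`, then `z ≐ L ⊗ y`, and with them every coordinate of `v`.
    c≢0 : c ≢ 0ℤ
    c≢0 c≡0 = v≢0 i₀ vi₀≢0
      where
      y≡0 : ∀ r j → y r j ≡ 0ℤ
      y≡0 r _ = trans (cong (Id n r i *_) c≡0) (*-zeroʳ (Id n r i))
      v≢0 : ∀ j → ¬ v j ≢ 0ℤ
      v≢0 zero    ≢0 = ≢0 c≡0
      v≢0 (suc j) ≢0 = ≢0 (ℤₚ.neg-injective (trans (sym (Ly≐z j zero))
        (∑-zero n (λ l → trans (cong (L j l *_) (y≡0 l zero)) (*-zeroʳ (L j l))))))

-- Inverses of upper unitriangular matrices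

∑M-⊗ : (A : Mat n n) (F : ℕ → Mat n n) → ∀ k → A ⊗ ∑M k F ≐ ∑M k (λ l → A ⊗ F l)
∑M-⊗ {n} A F zero    i j = ∑-zero n (λ l → *-zeroʳ (A i l))
∑M-⊗ {n} A F (suc k) i j =
  trans (∑-cong n (λ l → *-distribˡ-+ (A i l) (F k l j) (∑M k F l j)))
        (trans (∑-distrib-+ n (λ l → A i l * F k l j) (λ l → A i l * ∑M k F l j))
               (cong ((A ⊗ F k) i j +_) (∑M-⊗ A F k i j)))

module _ (U : Mat n n) (U-diag : ∀ i → U i i ≡ 1ℤ) (U-below : ∀ {i j} → toℕ j ℕ.< toℕ i → U i j ≡ 0ℤ) where

  private
    N : Mat n n
    N = Id n ⊖ U

  -- Both sides collect the powers of `N` with exponents 0 to `k`.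
  geometric : ∀ k i j → ∑M k (λ l → N ^^ suc l) i j + Id n i j ≡ (N ^^ k) i j + ∑M k (N ^^_) i j
  geometric zero    i j = trans (+-identityˡ (Id n i j)) (sym (+-identityʳ (Id n i j)))
  geometric (suc k) i j =
    trans (ℤₚ.+-assoc ((N ^^ suc k) i j) _ _) (cong ((N ^^ suc k) i j +_) (geometric k i j))

  N-below : ∀ {i j} → toℕ j ℕ.≤ toℕ i → N i j ≡ 0ℤ
  N-below {i} {j} j≤i with i ≟ j
  ... | yes refl = cong (λ z → 1ℤ - z) (U-diag i)
  ... | no  i≢j  = cong (λ z → 0ℤ - z) (U-below (ℕₚ.≤∧≢⇒< j≤i (i≢j ∘ sym ∘ Finₚ.toℕ-injective)))

  -- Each factor `N` moves the support one diagonal further up, so nothing is left at `k = n`.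
  N^^-below : ∀ k {i j} → toℕ j ℕ.< k ℕ.+ toℕ i → (N ^^ k) i j ≡ 0ℤ
  N^^-below zero    j<i = Id-≢ (λ { refl → ℕₚ.<-irrefl refl j<i })
  N^^-below (suc k) {i} {j} j<k+i = ∑-zero n vanish
    where
    vanish : ∀ l → N i l * (N ^^ k) l j ≡ 0ℤ
    vanish l with toℕ l ℕ.≤? toℕ i
    ... | yes l≤i = trans (cong (_* (N ^^ k) l j) (N-below l≤i)) (*-zeroˡ ((N ^^ k) l j))
    ... | no  l≰i = trans (cong (N i l *_) (N^^-below k (ℕₚ.<-≤-trans j<k+i
            (subst (ℕ._≤ k ℕ.+ toℕ l) (ℕₚ.+-suc k (toℕ i)) (ℕₚ.+-monoʳ-≤ k (ℕₚ.≰⇒> l≰i))))))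
            (*-zeroʳ (N i l))

  -- Id - N times the sum of the powers of `N` below n telescopes to Id - Nⁿ, and Nⁿ vanishes.
  ⊗-unitriInv : U ⊗ unitriInv U ≐ Id n
  ⊗-unitriInv i j = begin
    ∑ n (λ l → U i l * V l j)
      ≡⟨ ∑-cong n (λ l → U≡Id-N (Id n i l) (U i l) (V l j)) ⟩
    ∑ n (λ l → Id n i l * V l j + - 1ℤ * (N i l * V l j))
      ≡⟨ trans (∑-distrib-+ n _ _) (cong₂ _+_ (⊗-identityˡ V i j) (∑-*ˡ n (- 1ℤ) _)) ⟩
    V i j + - 1ℤ * (N ⊗ V) i j
      ≡⟨ cong (λ z → V i j + - 1ℤ * z) (∑M-⊗ N (N ^^_) n i j) ⟩
    V i j + - 1ℤ * S
      ≡⟨ solve-for V′ S (Id n i j) (trans (geometric n i j)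
           (trans (cong (_+ V i j) (N^^-below n (ℕₚ.<-≤-trans (Finₚ.toℕ<n j) (ℕₚ.m≤m+n n (toℕ i))))) (+-identityˡ _))) ⟩
    Id n i j ∎
    where
    open ≡-Reasoning
    V : Mat n n
    V = unitriInv U
    S V′ : ℤ
    S = ∑M n (λ l → N ^^ suc l) i j
    V′ = V i j
    U≡Id-N : ∀ d u v → u * v ≡ d * v + - 1ℤ * ((d - u) * v)
    U≡Id-N = solve-∀
    solve-for : ∀ v s d → s + d ≡ v → v + - 1ℤ * s ≡ d
    solve-for _ s d refl = lemma s d
      where
      lemma : ∀ s d → s + d + - 1ℤ * s ≡ d
      lemma = solve-∀

-- Transpositions

Arrow : ℕ → Set
Arrow m = Fin m × Fin m

swap : Arrow m → Fin m → Fin m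
swap (u , v) w with w ≟ u
... | yes _ = v
... | no  _ with w ≟ v
...   | yes _ = u
...   | no  _ = w

swap-fst : (u v : Fin m) → swap (u , v) u ≡ v
swap-fst u v with u ≟ u
... | yes _   = refl
... | no  u≢u = contradiction refl u≢u

swap-snd : (u v : Fin m) → swap (u , v) v ≡ u
swap-snd u v with v ≟ u
... | yes v≡u = v≡u
... | no  _ with v ≟ v
...   | yes _   = refl
...   | no  v≢v = contradiction refl v≢v

swap-other : {u v w : Fin m} → w ≢ u → w ≢ v → swap (u , v) w ≡ w
swap-other {u = u} {v} {w} w≢u w≢v with w ≟ u
... | yes w≡u = contradiction w≡u w≢u
... | no  _ with w ≟ v
...   | yes w≡v = contradiction w≡v w≢v
...   | no  _   = refl

-- Used with `g = swap x`, where it is the rule for conjugating a transposition, and with `g = suc`,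
-- where it compares transpositions with their shifts.
swap-natural : {g : Fin m → Fin n} → (∀ {u v} → g u ≡ g v → u ≡ v) →
               ∀ u v w → swap (g u , g v) (g w) ≡ g (swap (u , v) w)
swap-natural {g = g} g-inj u v w with w ≟ u
... | yes refl = swap-fst (g u) (g v)
... | no  w≢u with w ≟ v
...   | yes refl = swap-snd (g u) (g v)
...   | no  w≢v  = swap-other (w≢u ∘ g-inj) (w≢v ∘ g-inj)

swap-involutive : ∀ (x : Arrow m) w → swap x (swap x w) ≡ w
swap-involutive (u , v) w with w ≟ u
... | yes refl = swap-snd u v
... | no  w≢u with w ≟ v
...   | yes refl = swap-fst u v
...   | no  w≢v  = swap-other w≢u w≢v

swap-injective : ∀ (x : Arrow m) {w w′} → swap x w ≡ swap x w′ → w ≡ w′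
swap-injective x {w} {w′} eq =
  trans (sym (swap-involutive x w)) (trans (cong (swap x) eq) (swap-involutive x w′))

swap-flip : ∀ (u v w : Fin m) → swap (u , v) w ≡ swap (v , u) w
swap-flip u v w = go (w ≟ u) (w ≟ v)
  where
  go : Dec (w ≡ u) → Dec (w ≡ v) → swap (u , v) w ≡ swap (v , u) w
  go (yes refl) _          = trans (swap-fst u v) (sym (swap-snd v u))
  go (no _)     (yes refl) = trans (swap-snd u v) (sym (swap-fst v u))
  go (no w≢u)   (no w≢v)   = trans (swap-other w≢u w≢v) (sym (swap-other w≢v w≢u))

infixr 6 _▹_
-- The arrow of the conjugate x y x⁻¹; keeping the order of the ends fixes the sign of its `root`.
_▹_ : Arrow m → Arrow m → Arrow m
x ▹ (u , v) = swap x u , swap x v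

▹-involutive : (x y : Arrow m) → x ▹ x ▹ y ≡ y
▹-involutive x (u , v) = cong₂ _,_ (swap-involutive x u) (swap-involutive x v)

product : Vec (Arrow m) n → Fin m → Fin m
product []      w = w
product (x ∷ P) w = swap x (product P w)

-- Sequences of arrows

root : Arrow m → Fin m → ℤ
root {m} (u , v) i = Id m i u - Id m i v

root-flip : ∀ (u v i : Fin m) → root (v , u) i ≡ - root (u , v) i
root-flip {m} u v i = lemma (Id m i u) (Id m i v)
  where
  lemma : ∀ a b → b - a ≡ - (a - b)
  lemma = solve-∀

-- A transposition acts on basis vectors as the reflection Id - x xᵀ; for a loop the root is 0 and
-- both sides are the identity.
Id-swap : ∀ (x : Arrow m) w i → Id m i (swap x w) ≡ Id m i w - root x w * root x i
Id-swap {m} (u , v) w i = go (w ≟ u) (w ≟ v)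
  where
  loop : ∀ a b → a ≡ a - b * (a - a)
  loop = solve-∀
  fst : ∀ a b → b ≡ a - (1ℤ - 0ℤ) * (a - b)
  fst = solve-∀
  snd : ∀ a b → a ≡ b - (0ℤ - 1ℤ) * (a - b)
  snd = solve-∀
  other : ∀ a b → a ≡ a - (0ℤ - 0ℤ) * b
  other = solve-∀

  conclude : ∀ {w′ p q} → swap (u , v) w ≡ w′ → Id m w u ≡ p → Id m w v ≡ q →
             Id m i w′ ≡ Id m i w - (p - q) * root (u , v) i →
             Id m i (swap (u , v) w) ≡ Id m i w - root (u , v) w * root (u , v) i
  conclude refl refl refl eq = eq

  go : Dec (w ≡ u) → Dec (w ≡ v) →
       Id m i (swap (u , v) w) ≡ Id m i w - root (u , v) w * root (u , v) i
  go (yes refl) (yes refl) = conclude (swap-fst u u) refl refl (loop (Id m i u) (root (u , u) u))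
  go (yes refl) (no u≢v)   = conclude (swap-fst u v) (Id-refl u) (Id-≢ u≢v) (fst (Id m i u) (Id m i v))
  go (no v≢u)   (yes refl) = conclude (swap-snd u v) (Id-≢ v≢u) (Id-refl v) (snd (Id m i u) (Id m i v))
  go (no w≢u)   (no w≢v)   = conclude (swap-other w≢u w≢v) (Id-≢ w≢u) (Id-≢ w≢v) (other (Id m i w) (root (u , v) i))

_∙_ : Arrow m → Arrow m → ℤ
_∙_ {m} x y = ∑ m (λ i → root x i * root y i)

∙-ends : ∀ (x : Arrow m) (u v : Fin m) → x ∙ (u , v) ≡ root x u - root x v
∙-ends {m} x u v = begin
  ∑ m (λ i → root x i * (Id m i u - Id m i v))
    ≡⟨ ∑-cong m (λ i → expand (root x i) (Id m i u) (Id m i v)) ⟩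
  ∑ m (λ i → root x i * Id m i u + - 1ℤ * (root x i * Id m i v))
    ≡⟨ trans (∑-distrib-+ m _ _) (cong₂ _+_ (∑-Id m (root x) u) (∑-*ˡ m (- 1ℤ) _)) ⟩
  root x u + - 1ℤ * ∑ m (λ i → root x i * Id m i v)
    ≡⟨ cong (λ z → root x u + - 1ℤ * z) (∑-Id m (root x) v) ⟩
  root x u + - 1ℤ * root x v
    ≡⟨ collect (root x u) (root x v) ⟩
  root x u - root x v ∎
  where
  open ≡-Reasoning
  expand : ∀ a b c → a * (b - c) ≡ a * b + - 1ℤ * (a * c)
  expand = solve-∀
  collect : ∀ a b → a + - 1ℤ * b ≡ a - b
  collect = solve-∀

∙-self : ∀ {u v : Fin m} → u ≢ v → (u , v) ∙ (u , v) ≡ 1ℤ + 1ℤ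
∙-self {m} {u} {v} u≢v = trans (∙-ends (u , v) u v)
  (cong₂ _-_ (cong₂ _-_ (Id-refl u) (Id-≢ u≢v)) (cong₂ _-_ (Id-≢ (u≢v ∘ sym)) (Id-refl v)))

root-▹ : ∀ (x y : Arrow m) i → root (x ▹ y) i ≡ root y i - x ∙ y * root x i
root-▹ {m} x (u , v) i = begin
  Id m i (swap x u) - Id m i (swap x v)
    ≡⟨ cong₂ _-_ (Id-swap x u i) (Id-swap x v i) ⟩
  Id m i u - root x u * root x i - (Id m i v - root x v * root x i)
    ≡⟨ collect (Id m i u) (Id m i v) (root x u) (root x v) (root x i) ⟩
  Id m i u - Id m i v - (root x u - root x v) * root x i
    ≡⟨ cong (λ z → root (u , v) i - z * root x i) (sym (∙-ends x u v)) ⟩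
  root (u , v) i - x ∙ (u , v) * root x i ∎
  where
  open ≡-Reasoning
  collect : ∀ a b c d r → a - c * r - (b - d * r) ≡ a - b - (c - d) * r
  collect = solve-∀

inc : Vec (Arrow m) n → Mat m n
inc P i j = root (lookup P j) i

-- Recursive form of Ǧ: an arrow put in front borders the matrix, which suits induction on the
-- sequence.
uni : Vec (Arrow m) n → Mat n n
uni (x ∷ P) zero    zero    = 1ℤ
uni (x ∷ P) zero    (suc j) = x ∙ lookup P j
uni (x ∷ P) (suc i) zero    = 0ℤ
uni (x ∷ P) (suc i) (suc j) = uni P i j

uni-diag : ∀ (P : Vec (Arrow m) n) i → uni P i i ≡ 1ℤ
uni-diag (x ∷ P) zero    = refl
uni-diag (x ∷ P) (suc i) = uni-diag P i

uni-below : ∀ (P : Vec (Arrow m) n) {i j} → toℕ j ℕ.< toℕ i → uni P i j ≡ 0ℤ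
uni-below (x ∷ P) {suc i} {zero}  _           = refl
uni-below (x ∷ P) {suc i} {suc j} (ℕ.s≤s j<i) = uni-below P j<i

uni-above : ∀ (P : Vec (Arrow m) n) {i j} → toℕ i ℕ.< toℕ j → uni P i j ≡ lookup P i ∙ lookup P j
uni-above (x ∷ P) {zero}  {suc j} _           = refl
uni-above (x ∷ P) {suc i} {suc j} (ℕ.s≤s i<j) = uni-above P i<j

∙-product : ∀ (x : Arrow m) (P : Vec (Arrow m) n) (D : Mat n m) →
  (∀ i j → (inc P ⊗ D) i j ≡ Id m i j - Id m i (product P j)) →
  ∀ j → ∑ n (λ l → x ∙ lookup P l * D l j) ≡ root x j - root x (product P j)
∙-product {m} {n} x P D hyp j = begin
  ∑ n (λ l → ∑ m (λ i → root x i * inc P i l) * D l j)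
    ≡⟨ ⊗-assoc X (inc P) D zero j ⟩
  ∑ m (λ i → root x i * (inc P ⊗ D) i j)
    ≡⟨ ∑-cong m (λ i → cong (root x i *_) (hyp i j)) ⟩
  x ∙ (j , product P j)
    ≡⟨ ∙-ends x j (product P j) ⟩
  root x j - root x (product P j) ∎
  where
  open ≡-Reasoning
  X : Mat 1 m
  X _ = root x

-- The Coxeter-Laplacian as the matrix of a product of transpositions

record Resolvent (P : Vec (Arrow m) n) : Set where
  field
    W           : Mat n n
    W-inverseˡ  : W ⊗ uni P ≐ Id n
    inc-W-incᵀ : ∀ i j → (inc P ⊗ (W ⊗ inc P ᵀ)) i j ≡ Id m i j - Id m i (product P j)

-- Bordering U by the row xᵀI borders its inverse W by the row -xᵀIW. Then Id - I⁺W⁺I⁺ᵀ = (Id - x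
-- xᵀ)(Id - I W Iᵀ), where the first factor is the matrix of `swap x`.
resolvent : (P : Vec (Arrow m) n) → Resolvent P
resolvent [] = record { W = λ () ; W-inverseˡ = λ () ; inc-W-incᵀ = λ i j → sym (ℤₚ.+-inverseʳ (Id _ i j)) }
resolvent {m} {suc n} (x ∷ P) = record { W = W⁺ ; W-inverseˡ = inverse ; inc-W-incᵀ = formula }
  where
  open Resolvent (resolvent P)
  open ≡-Reasoning

  r : Fin n → ℤ
  r j = ∑ n (λ l → - (x ∙ lookup P l) * W l j)

  W⁺ : Mat (suc n) (suc n)
  W⁺ zero    zero    = 1ℤ
  W⁺ zero    (suc j) = r j
  W⁺ (suc i) zero    = 0ℤ
  W⁺ (suc i) (suc j) = W i j

  c : Mat 1 n
  c _ l = - (x ∙ lookup P l)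

  inverse : W⁺ ⊗ uni (x ∷ P) ≐ Id (suc n)
  inverse zero zero = cong (1ℤ * 1ℤ +_) (∑-zero n (λ l → *-zeroʳ (r l)))
  inverse zero (suc j) = trans
    (cong₂ _+_ (*-identityˡ (x ∙ lookup P j))
      (trans (⊗-assoc c W (uni P) zero j) (trans (⊗-congˡ c W-inverseˡ zero j) (⊗-identityʳ c zero j))))
    (ℤₚ.+-inverseʳ (x ∙ lookup P j))
  inverse (suc i) zero = trans (+-identityˡ _) (∑-zero n (λ l → *-zeroʳ (W i l)))
  inverse (suc i) (suc j) = trans (cong (_+ (W ⊗ uni P) i j) (*-zeroˡ (x ∙ lookup P j)))
    (trans (+-identityˡ _) (trans (W-inverseˡ i j) (sym (Id-suc i j))))

  D : Mat n m
  D = W ⊗ inc P ᵀ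

  formula : ∀ i j → (inc (x ∷ P) ⊗ (W⁺ ⊗ inc (x ∷ P) ᵀ)) i j ≡ Id m i j - Id m i (product (x ∷ P) j)
  formula i j = begin
    root x i * (1ℤ * root x j + ∑ n (λ l → r l * inc P j l)) + ∑ n (λ l → inc P i l * (0ℤ * root x j + D l j))
      ≡⟨ cong₂ (λ a b → root x i * (1ℤ * root x j + a) + b) first
           (trans (∑-cong n (λ l → cong (inc P i l *_) (trans (cong (_+ D l j) (*-zeroˡ (root x j))) (+-identityˡ (D l j))))) (inc-W-incᵀ i j)) ⟩
    root x i * (1ℤ * root x j + - 1ℤ * (root x j - root x w)) + (Id m i j - Id m i w)
      ≡⟨ collect (root x i) (root x j) (root x w) (Id m i j) (Id m i w) ⟩
    Id m i j - (Id m i w - root x w * root x i)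
      ≡⟨ cong (λ z → Id m i j - z) (sym (Id-swap x w i)) ⟩
    Id m i j - Id m i (swap x w) ∎
    where
    w : Fin m
    w = product P j
    collect : ∀ a b c d e → a * (1ℤ * b + - 1ℤ * (b - c)) + (d - e) ≡ d - (e - c * a)
    collect = solve-∀
    negate : ∀ a b → - a * b ≡ - 1ℤ * (a * b)
    negate = solve-∀
    first : ∑ n (λ l → r l * inc P j l) ≡ - 1ℤ * (root x j - root x w)
    first = begin
      ∑ n (λ l → r l * inc P j l)
        ≡⟨ ⊗-assoc c W (inc P ᵀ) zero j ⟩
      ∑ n (λ l → - (x ∙ lookup P l) * D l j)
        ≡⟨ trans (∑-cong n (λ l → negate (x ∙ lookup P l) (D l j))) (∑-*ˡ n (- 1ℤ) _) ⟩
      - 1ℤ * ∑ n (λ l → x ∙ lookup P l * D l j)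
        ≡⟨ cong (- 1ℤ *_) (∙-product x P D inc-W-incᵀ j) ⟩
      - 1ℤ * (root x j - root x w) ∎

-- Congruence of pairs (I , Ǧ)

module _ (U Ũ W̃ B : Mat n n) (W̃-inverseˡ : W̃ ⊗ Ũ ≐ Id n) (Ũ≐BᵀUB : Ũ ≐ B ᵀ ⊗ U ⊗ B) where

  -- Multiplying the congruence by `W̃` exhibits an integral left inverse of `B`, the source of its
  -- ℤ-invertibility.
  congruence-leftInverse : W̃ ⊗ (B ᵀ ⊗ U) ⊗ B ≐ Id n
  congruence-leftInverse =
    ≐-trans (⊗-assoc W̃ (B ᵀ ⊗ U) B) (≐-trans (⊗-congˡ W̃ (≐-sym Ũ≐BᵀUB)) W̃-inverseˡ)

  congruence-rightInverse : B ⊗ (W̃ ⊗ (B ᵀ ⊗ U)) ≐ Id n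
  congruence-rightInverse = left⇒right-inverse (W̃ ⊗ (B ᵀ ⊗ U)) B congruence-leftInverse

  -- This is U⁻¹ = B Ũ⁻¹ Bᵀ; regrouped, the product is `B` times its right inverse.
  congruence-inverse : B ⊗ (W̃ ⊗ B ᵀ) ⊗ U ≐ Id n
  congruence-inverse = begin
    B ⊗ (W̃ ⊗ B ᵀ) ⊗ U   ≈⟨ ⊗-assoc B (W̃ ⊗ B ᵀ) U ⟩
    B ⊗ (W̃ ⊗ B ᵀ ⊗ U)   ≈⟨ ⊗-congˡ B (⊗-assoc W̃ (B ᵀ) U) ⟩
    B ⊗ (W̃ ⊗ (B ᵀ ⊗ U)) ≈⟨ congruence-rightInverse ⟩
    Id n ∎
    where open ≐-Reasoning

-- Condition (iii) for arbitrary pairs of matrices, shared by quivers and sequences of arrows.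
Congruent : Mat m n → Mat n n → Mat m n → Mat n n → Set
Congruent {n = n} I U Ĩ Ũ = Σ (Mat n n) λ B → (I ⊗ B ≐ Ĩ) × (Ũ ≐ B ᵀ ⊗ U ⊗ B)

ᵀ-⊗-pull : (B C U : Mat n n) → (B ⊗ C) ᵀ ⊗ U ⊗ (B ⊗ C) ≐ C ᵀ ⊗ (B ᵀ ⊗ U ⊗ B) ⊗ C
ᵀ-⊗-pull B C U = begin
  (B ⊗ C) ᵀ ⊗ U ⊗ (B ⊗ C)      ≈⟨ ⊗-congʳ (B ⊗ C) (⊗-congʳ U (⊗-ᵀ B C)) ⟩
  C ᵀ ⊗ B ᵀ ⊗ U ⊗ (B ⊗ C)      ≈⟨ ⊗-assoc (C ᵀ ⊗ B ᵀ ⊗ U) B C ⟨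
  C ᵀ ⊗ B ᵀ ⊗ U ⊗ B ⊗ C        ≈⟨ ⊗-congʳ C (⊗-congʳ B (⊗-assoc (C ᵀ) (B ᵀ) U)) ⟩
  C ᵀ ⊗ (B ᵀ ⊗ U) ⊗ B ⊗ C      ≈⟨ ⊗-congʳ C (⊗-assoc (C ᵀ) (B ᵀ ⊗ U) B) ⟩
  C ᵀ ⊗ (B ᵀ ⊗ U ⊗ B) ⊗ C      ∎
  where open ≐-Reasoning

Congruent-refl : (I : Mat m n) (U : Mat n n) → Congruent I U I U
Congruent-refl {n = n} I U = Id n , ⊗-identityʳ I , ≐-sym (begin
  Id n ᵀ ⊗ U ⊗ Id n  ≈⟨ ⊗-identityʳ (Id n ᵀ ⊗ U) ⟩
  Id n ᵀ ⊗ U         ≈⟨ ⊗-congʳ U (λ i j → Id-sym j i) ⟩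
  Id n ⊗ U           ≈⟨ ⊗-identityˡ U ⟩
  U                  ∎)
  where open ≐-Reasoning

Congruent-trans : {I₁ I₂ I₃ : Mat m n} {U₁ U₂ U₃ : Mat n n} →
                  Congruent I₁ U₁ I₂ U₂ → Congruent I₂ U₂ I₃ U₃ → Congruent I₁ U₁ I₃ U₃
Congruent-trans {I₁ = I₁} {U₁ = U₁} (B , IB , UB) (C , IC , UC) =
  B ⊗ C ,
  ≐-trans (≐-sym (⊗-assoc I₁ B C)) (≐-trans (⊗-congʳ C IB) IC) ,
  ≐-trans UC (≐-trans (⊗-congʳ C (⊗-congˡ (C ᵀ) UB)) (≐-sym (ᵀ-⊗-pull B C U₁)))

-- The left inverse of `Ũ` makes `B` invertible, and B⁻¹ = W̃BᵀU carries the pair back.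
Congruent-sym : {I Ĩ : Mat m n} {U Ũ : Mat n n} (W̃ : Mat n n) → W̃ ⊗ Ũ ≐ Id n →
                Congruent I U Ĩ Ũ → Congruent Ĩ Ũ I U
Congruent-sym {n = n} {I} {Ĩ} {U} {Ũ} W̃ W̃Ũ≐Id (B , IB , UB) = C ,
  (begin
    Ĩ ⊗ C        ≈⟨ ⊗-congʳ C IB ⟨
    I ⊗ B ⊗ C    ≈⟨ ⊗-assoc I B C ⟩
    I ⊗ (B ⊗ C)  ≈⟨ ⊗-congˡ I BC≐Id ⟩
    I ⊗ Id n     ≈⟨ ⊗-identityʳ I ⟩
    I            ∎) ,
  (begin
    U                            ≈⟨ proj₂ (proj₂ (Congruent-refl I U)) ⟩
    Id n ᵀ ⊗ U ⊗ Id n            ≈⟨ ⊗-cong (⊗-congʳ U (λ i j → BC≐Id j i)) BC≐Id ⟨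
    (B ⊗ C) ᵀ ⊗ U ⊗ (B ⊗ C)      ≈⟨ ᵀ-⊗-pull B C U ⟩
    C ᵀ ⊗ (B ᵀ ⊗ U ⊗ B) ⊗ C      ≈⟨ ⊗-congʳ C (⊗-congˡ (C ᵀ) UB) ⟨
    C ᵀ ⊗ Ũ ⊗ C                  ∎)
  where
  open ≐-Reasoning
  C : Mat n n
  C = W̃ ⊗ (B ᵀ ⊗ U)
  BC≐Id : B ⊗ C ≐ Id n
  BC≐Id = congruence-rightInverse U Ũ W̃ B W̃Ũ≐Id UB

_≅_ : Vec (Arrow m) n → Vec (Arrow m) n → Set
P ≅ P′ = Congruent (inc P) (uni P) (inc P′) (uni P′)

≅-sym : {P P′ : Vec (Arrow m) n} → P ≅ P′ → P′ ≅ P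
≅-sym {P = P} {P′} = Congruent-sym {I = inc P} {inc P′} {uni P} {uni P′}
  W W-inverseˡ
  where open Resolvent (resolvent P′)

module _ {x x′ : Arrow m} (ε : ℤ) (ε²≡1 : ε * ε ≡ 1ℤ) (x′≡xε : ∀ i → root x′ i ≡ root x i * ε) where

  -- The block diagonal matrix of `ε` and `B`: sign 1 keeps a common first arrow, sign -1 reverses
  -- it.
  ≅-cons : {P P′ : Vec (Arrow m) n} → P ≅ P′ → (x ∷ P) ≅ (x′ ∷ P′)
  ≅-cons {n} {P} {P′} (B , IB , UB) = B⁺ , IB⁺ , UB⁺
    where
    open ≡-Reasoning
    B⁺ : Mat (suc n) (suc n)
    B⁺ zero    zero    = ε
    B⁺ zero    (suc j) = 0ℤ
    B⁺ (suc i) zero    = 0ℤ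
    B⁺ (suc i) (suc j) = B i j

    ⊗-zero : ∀ {k} (A : Mat k (suc n)) i → (A ⊗ B⁺) i zero ≡ A i zero * ε
    ⊗-zero A i = trans (cong ((A i zero * ε) +_) (∑-zero n (λ l → *-zeroʳ (A i (suc l))))) (+-identityʳ _)

    ⊗-suc : ∀ {k} (A : Mat k (suc n)) i j → (A ⊗ B⁺) i (suc j) ≡ ∑ n (λ l → A i (suc l) * B l j)
    ⊗-suc A i j = trans (cong (_+ ∑ n (λ l → A i (suc l) * B l j)) (*-zeroʳ (A i zero))) (+-identityˡ _)

    IB⁺ : inc (x ∷ P) ⊗ B⁺ ≐ inc (x′ ∷ P′)
    IB⁺ i zero    = trans (⊗-zero (inc (x ∷ P)) i) (sym (x′≡xε i))
    IB⁺ i (suc j) = trans (⊗-suc (inc (x ∷ P)) i j) (IB i j)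

    U⁺ M : Mat (suc n) (suc n)
    U⁺ = uni (x ∷ P)
    M = B⁺ ᵀ ⊗ U⁺

    M-zero : ∀ j → M zero j ≡ U⁺ zero j * ε
    M-zero j = trans (sym (⊗-ᵀ (U⁺ ᵀ) B⁺ zero j)) (⊗-zero (U⁺ ᵀ) j)

    M-suc : ∀ i j → M (suc i) j ≡ ∑ n (λ l → U⁺ (suc l) j * B l i)
    M-suc i j = trans (sym (⊗-ᵀ (U⁺ ᵀ) B⁺ (suc i) j)) (⊗-suc (U⁺ ᵀ) j i)

    X : Mat 1 m
    X _ = root x

    UB⁺ : uni (x′ ∷ P′) ≐ B⁺ ᵀ ⊗ U⁺ ⊗ B⁺
    UB⁺ zero zero = sym (trans (⊗-zero M zero) (trans (cong (_* ε) (M-zero zero))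
      (trans (cong (_* ε) (*-identityˡ ε)) ε²≡1)))
    -- The new border ε xᵀIB becomes x′ᵀI′ through `IB`, so the incidence half of the congruence
    -- enters the triangular half.
    UB⁺ zero (suc j) = sym (begin
      (M ⊗ B⁺) zero (suc j)
        ≡⟨ ⊗-suc M zero j ⟩
      ∑ n (λ l → M zero (suc l) * B l j)
        ≡⟨ ∑-cong n (λ l → trans (cong (_* B l j) (M-zero (suc l))) (rearrange (x ∙ lookup P l) ε (B l j))) ⟩
      ∑ n (λ l → ε * (x ∙ lookup P l * B l j))
        ≡⟨ ∑-*ˡ n ε _ ⟩
      ε * (X ⊗ inc P ⊗ B) zero j
        ≡⟨ cong (ε *_) (trans (⊗-assoc X (inc P) B zero j) (⊗-congˡ X IB zero j)) ⟩
      ε * (X ⊗ inc P′) zero j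
        ≡⟨ sym (∑-*ˡ m ε _) ⟩
      ∑ m (λ i → ε * (root x i * inc P′ i j))
        ≡⟨ ∑-cong m (λ i → trans (sym (rearrange (root x i) ε (inc P′ i j))) (cong (_* inc P′ i j) (sym (x′≡xε i)))) ⟩
      x′ ∙ lookup P′ j ∎)
      where
      rearrange : ∀ a e b → a * e * b ≡ e * (a * b)
      rearrange = solve-∀
    UB⁺ (suc i) zero = sym (trans (⊗-zero M (suc i))
      (cong (_* ε) (trans (M-suc i zero) (∑-zero n (λ l → *-zeroˡ (B l i))))))
    UB⁺ (suc i) (suc j) = sym (begin
      (M ⊗ B⁺) (suc i) (suc j)
        ≡⟨ ⊗-suc M (suc i) j ⟩
      ∑ n (λ l → M (suc i) (suc l) * B l j)
        ≡⟨ ∑-cong n (λ l → cong (_* B l j) (trans (M-suc i (suc l)) (∑-cong n (λ h → *-comm (uni P h l) (B h i))))) ⟩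
      (B ᵀ ⊗ uni P ⊗ B) i j
        ≡⟨ sym (UB i j) ⟩
      uni P′ i j ∎)

≅-∷ : (x : Arrow m) {P P′ : Vec (Arrow m) n} → P ≅ P′ → (x ∷ P) ≅ (x ∷ P′)
≅-∷ x {P} {P′} = ≅-cons 1ℤ refl (λ i → sym (*-identityʳ (root x i))) {P = P} {P′}

≅-flip : (u v : Fin m) (P : Vec (Arrow m) n) → ((u , v) ∷ P) ≅ ((v , u) ∷ P)
≅-flip u v P = ≅-cons (- 1ℤ) refl (λ i → trans (root-flip u v i) (lemma (root (u , v) i))) {P = P} {P}
  (Congruent-refl (inc P) (uni P))
  where
  lemma : ∀ a → - a ≡ a * - 1ℤ
  lemma = solve-∀

∙-comm : (x y : Arrow m) → x ∙ y ≡ y ∙ x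
∙-comm {m} x y = ∑-cong m (λ i → *-comm (root x i) (root y i))

▹-∙ : (x y z : Arrow m) → (x ▹ y) ∙ z ≡ y ∙ z - x ∙ y * (x ∙ z)
▹-∙ {m} x y z = begin
  ∑ m (λ i → root (x ▹ y) i * root z i)
    ≡⟨ ∑-cong m (λ i → trans (cong (_* root z i) (root-▹ x y i)) (expand (root y i) (x ∙ y) (root x i) (root z i))) ⟩
  ∑ m (λ i → root y i * root z i + - (x ∙ y) * (root x i * root z i))
    ≡⟨ trans (∑-distrib-+ m _ _) (cong (y ∙ z +_) (∑-*ˡ m (- (x ∙ y)) _)) ⟩
  y ∙ z + - (x ∙ y) * (x ∙ z)
    ≡⟨ collect (y ∙ z) (x ∙ y) (x ∙ z) ⟩
  y ∙ z - x ∙ y * (x ∙ z) ∎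
  where
  open ≡-Reasoning
  expand : ∀ a c b d → (a - c * b) * d ≡ a * d + - c * (b * d)
  expand = solve-∀
  collect : ∀ a c b → a + - c * b ≡ a - c * b
  collect = solve-∀

-- `B` replaces the columns x, y by y - c x, x. The entry below the diagonal is c - c = 0, so the
-- matrix stays triangular; the entry above it is c - 2c, where x · x = 2 uses that `x` is proper.
≅-braid : {u v : Fin m} → u ≢ v → (y : Arrow m) (P : Vec (Arrow m) n) →
          ((u , v) ∷ y ∷ P) ≅ (((u , v) ▹ y) ∷ (u , v) ∷ P)
≅-braid {m} {n} {u} {v} u≢v y P = B , IB , UB
  where
  open ≡-Reasoning
  x : Arrow m
  x = u , v
  c : ℤ
  c = x ∙ y

  B : Mat (suc (suc n)) (suc (suc n))
  B zero          zero          = - c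
  B (suc zero)    zero          = 1ℤ
  B (suc (suc _)) zero          = 0ℤ
  B zero          (suc zero)    = 1ℤ
  B (suc zero)    (suc zero)    = 0ℤ
  B (suc (suc _)) (suc zero)    = 0ℤ
  B zero          (suc (suc _)) = 0ℤ
  B (suc zero)    (suc (suc _)) = 0ℤ
  B (suc (suc i)) (suc (suc j)) = Id n i j

  -- The effect of `B` on a row from the right; applied to columns and then to rows of `U` it
  -- computes BᵀUB.
  act : (Fin (suc (suc n)) → ℤ) → Fin (suc (suc n)) → ℤ
  act f zero          = f (suc zero) - c * f zero
  act f (suc zero)    = f zero
  act f (suc (suc j)) = f (suc (suc j))

  ⊗B : ∀ {k} (A : Mat k (suc (suc n))) i j → (A ⊗ B) i j ≡ act (A i) j
  ⊗B A i zero = trans (cong (λ z → A i zero * - c + (A i (suc zero) * 1ℤ + z)) (∑-zero n (λ l → *-zeroʳ (A i (suc (suc l))))))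
    (lemma (A i zero) (A i (suc zero)) c)
    where
    lemma : ∀ a b c → a * - c + (b * 1ℤ + 0ℤ) ≡ b - c * a
    lemma = solve-∀
  ⊗B A i (suc zero) = trans (cong (λ z → A i zero * 1ℤ + (A i (suc zero) * 0ℤ + z)) (∑-zero n (λ l → *-zeroʳ (A i (suc (suc l))))))
    (lemma (A i zero) (A i (suc zero)))
    where
    lemma : ∀ a b → a * 1ℤ + (b * 0ℤ + 0ℤ) ≡ a
    lemma = solve-∀
  ⊗B A i (suc (suc j)) = trans (cong (λ z → A i zero * 0ℤ + (A i (suc zero) * 0ℤ + z)) (∑-Id n (λ l → A i (suc (suc l))) j))
    (lemma (A i zero) (A i (suc zero)) (A i (suc (suc j))))
    where
    lemma : ∀ a b d → a * 0ℤ + (b * 0ℤ + d) ≡ d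
    lemma = solve-∀

  act-cong : ∀ {f g} → (∀ j → f j ≡ g j) → ∀ j → act f j ≡ act g j
  act-cong f≗g zero          = cong₂ (λ a b → a - c * b) (f≗g (suc zero)) (f≗g zero)
  act-cong f≗g (suc zero)    = f≗g zero
  act-cong f≗g (suc (suc j)) = f≗g (suc (suc j))

  IB : inc (x ∷ y ∷ P) ⊗ B ≐ inc ((x ▹ y) ∷ x ∷ P)
  IB i zero          = trans (⊗B (inc (x ∷ y ∷ P)) i zero) (sym (root-▹ x y i))
  IB i (suc zero)    = ⊗B (inc (x ∷ y ∷ P)) i (suc zero)
  IB i (suc (suc j)) = ⊗B (inc (x ∷ y ∷ P)) i (suc (suc j))

  U : Mat (suc (suc n)) (suc (suc n))
  U = uni (x ∷ y ∷ P)

  BᵀUB : ∀ i j → (B ᵀ ⊗ U ⊗ B) i j ≡ act (λ l → act (λ h → U h l) i) j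
  BᵀUB i j = trans (⊗B (B ᵀ ⊗ U) i j)
    (act-cong (λ l → trans (sym (⊗-ᵀ (U ᵀ) B i l)) (⊗B (U ᵀ) l i)) j)

  entries : ∀ i j → uni ((x ▹ y) ∷ x ∷ P) i j ≡ act (λ l → act (λ h → U h l) i) j
  entries zero zero = lemma c
    where
    lemma : ∀ c → 1ℤ ≡ 1ℤ - c * c - c * (0ℤ - c * 1ℤ)
    lemma = solve-∀
  entries zero (suc zero) = begin
    (x ▹ y) ∙ x            ≡⟨ ▹-∙ x y x ⟩
    y ∙ x - c * (x ∙ x)    ≡⟨ cong₂ (λ a b → a - c * b) (∙-comm y x) (∙-self u≢v) ⟩
    c - c * (1ℤ + 1ℤ)      ≡⟨ lemma c ⟩
    0ℤ - c * 1ℤ            ∎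
    where
    lemma : ∀ c → c - c * (1ℤ + 1ℤ) ≡ 0ℤ - c * 1ℤ
    lemma = solve-∀
  entries zero (suc (suc j)) = ▹-∙ x y (lookup P j)
  entries (suc zero) zero = lemma c
    where
    lemma : ∀ c → 0ℤ ≡ c - c * 1ℤ
    lemma = solve-∀
  entries (suc zero) (suc zero) = refl
  entries (suc zero) (suc (suc j)) = refl
  entries (suc (suc i)) zero = lemma c
    where
    lemma : ∀ c → 0ℤ ≡ 0ℤ - c * 0ℤ
    lemma = solve-∀
  entries (suc (suc i)) (suc zero) = refl
  entries (suc (suc i)) (suc (suc j)) = refl

  UB : uni ((x ▹ y) ∷ x ∷ P) ≐ B ᵀ ⊗ U ⊗ B
  UB i j = trans (entries i j) (sym (BᵀUB i j))

-- Hurwitz transitivity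

Proper : Arrow m → Set
Proper (u , v) = u ≢ v

infix 4 _~_
-- Hurwitz equivalence, with reversals added because arrows are oriented and transpositions are not;
-- `~-∷` allows a move at any position.
data _~_ : Vec (Arrow m) n → Vec (Arrow m) n → Set where
  ~-refl  : {P : Vec (Arrow m) n} → P ~ P
  ~-sym   : {P P′ : Vec (Arrow m) n} → P ~ P′ → P′ ~ P
  ~-trans : {P P′ P″ : Vec (Arrow m) n} → P ~ P′ → P′ ~ P″ → P ~ P″
  ~-∷     : (x : Arrow m) {P P′ : Vec (Arrow m) n} → P ~ P′ → x ∷ P ~ x ∷ P′
  flip    : (u v : Fin m) (P : Vec (Arrow m) n) → (u , v) ∷ P ~ (v , u) ∷ P
  braid   : {x : Arrow m} → Proper x → (y : Arrow m) (P : Vec (Arrow m) n) →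
            x ∷ y ∷ P ~ (x ▹ y) ∷ x ∷ P

braid≡ : {x : Arrow m} → Proper x → {y z : Arrow m} → x ▹ y ≡ z → (P : Vec (Arrow m) n) →
         x ∷ y ∷ P ~ z ∷ x ∷ P
braid≡ x-proper refl P = braid x-proper _ P

~⇒≅ : {P P′ : Vec (Arrow m) n} → P ~ P′ → P ≅ P′
~⇒≅ {P = P} ~-refl = Congruent-refl (inc P) (uni P)
~⇒≅ {P = P} {P′} (~-sym p) = ≅-sym {P = P′} {P} (~⇒≅ p)
~⇒≅ (~-trans {P = P} {P′} {P″} p q) =
  Congruent-trans {I₁ = inc P} {inc P′} {inc P″} {uni P} {uni P′} {uni P″} (~⇒≅ p) (~⇒≅ q)
~⇒≅ (~-∷ x {P} {P′} p) = ≅-∷ x {P = P} {P′} (~⇒≅ p)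
~⇒≅ (flip u v P) = ≅-flip u v P
~⇒≅ (braid x-proper y P) = ≅-braid x-proper y P

~⇒product : {P P′ : Vec (Arrow m) n} → P ~ P′ → ∀ w → product P w ≡ product P′ w
~⇒product ~-refl        w = refl
~⇒product (~-sym p)     w = sym (~⇒product p w)
~⇒product (~-trans p q) w = trans (~⇒product p w) (~⇒product q w)
~⇒product (~-∷ x p)     w = cong (swap x) (~⇒product p w)
~⇒product (flip u v P)  w = swap-flip u v (product P w)
-- This is x y = (x y x⁻¹) x.
~⇒product (braid {x = x} _ (u , v) P) w = sym (swap-natural (swap-injective x) u v (product P w))

▹-proper : (x : Arrow m) {y : Arrow m} → Proper y → Proper (x ▹ y)
▹-proper x y-proper = y-proper ∘ swap-injective x

~⇒proper : {P P′ : Vec (Arrow m) n} → P ~ P′ →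
           (All Proper P → All Proper P′) × (All Proper P′ → All Proper P)
~⇒proper ~-refl        = (λ ps → ps) , (λ ps → ps)
~⇒proper (~-sym p)     = proj₂ (~⇒proper p) , proj₁ (~⇒proper p)
~⇒proper (~-trans p q) = proj₁ (~⇒proper q) ∘ proj₁ (~⇒proper p) , proj₂ (~⇒proper p) ∘ proj₂ (~⇒proper q)
~⇒proper (~-∷ x p)     = (λ { (px ∷ ps) → px ∷ proj₁ (~⇒proper p) ps }) , (λ { (px ∷ ps) → px ∷ proj₂ (~⇒proper p) ps })
~⇒proper (flip u v P)  = (λ { (px ∷ ps) → px ∘ sym ∷ ps }) , (λ { (px ∷ ps) → px ∘ sym ∷ ps })
~⇒proper (braid {x = x} x-proper y P) =
  (λ { (px ∷ py ∷ ps) → ▹-proper x {y} py ∷ px ∷ ps }) ,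
  (λ { (py ∷ px ∷ ps) → px ∷ py ∘ cong (swap x) ∷ ps })

Links : Rel (Fin m) 0ℓ → Vec (Arrow m) n → Set
Links R = All (λ (u , v) → R u v)

-- Connectedness, encoded by the universal property of the generated equivalence relation.
Linked : Vec (Arrow m) n → Set₁
Linked {m} P = (R : Rel (Fin m) 0ℓ) → IsEquivalence R → Links R P → ∀ u v → R u v

module _ {R : Rel (Fin m) 0ℓ} (R-equiv : IsEquivalence R) where
  private module R = IsEquivalence R-equiv

  swap-related : ∀ {u v} → R u v → ∀ w → R (swap (u , v) w) w
  swap-related {u} {v} uRv w with w ≟ u
  ... | yes refl = R.sym uRv
  ... | no  _ with w ≟ v
  ...   | yes refl = uRv
  ...   | no  _    = R.refl

  -- A braid move displaces ends of arrows by `swap x` only, which stays within the classes of `R`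
  -- once the ends of `x` are related.
  ~⇒links : {P P′ : Vec (Arrow m) n} → P ~ P′ →
            (Links R P → Links R P′) × (Links R P′ → Links R P)
  ~⇒links ~-refl        = (λ ps → ps) , (λ ps → ps)
  ~⇒links (~-sym p)     = proj₂ (~⇒links p) , proj₁ (~⇒links p)
  ~⇒links (~-trans p q) = proj₁ (~⇒links q) ∘ proj₁ (~⇒links p) , proj₂ (~⇒links p) ∘ proj₂ (~⇒links q)
  ~⇒links (~-∷ x p)     = (λ { (px ∷ ps) → px ∷ proj₁ (~⇒links p) ps }) , (λ { (px ∷ ps) → px ∷ proj₂ (~⇒links p) ps })
  ~⇒links (flip u v P)  = (λ { (px ∷ ps) → R.sym px ∷ ps }) , (λ { (px ∷ ps) → R.sym px ∷ ps })
  ~⇒links (braid _ (u , v) P) =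
    (λ { (px ∷ py ∷ ps) → R.trans (swap-related px u) (R.trans py (R.sym (swap-related px v))) ∷ px ∷ ps }) ,
    (λ { (py ∷ px ∷ ps) → px ∷ R.trans (R.sym (swap-related px u)) (R.trans py (swap-related px v)) ∷ ps })

~⇒linked : {P P′ : Vec (Arrow m) n} → P ~ P′ → Linked P → Linked P′
~⇒linked p linked R R-equiv = linked R R-equiv ∘ proj₂ (~⇒links R-equiv p)

-- The pair x x multiplies to the identity, so `y` is conjugated twice and returns to itself.
slide : {x : Arrow m} → Proper x → (y : Arrow m) (P : Vec (Arrow m) n) → x ∷ x ∷ y ∷ P ~ y ∷ x ∷ x ∷ P
slide {x = x} x-proper y P =
  ~-trans (~-∷ x (braid x-proper y P)) (braid≡ x-proper (▹-involutive x y) (x ∷ P))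

-- The pair slides to the far side of `y`; braiding `y` over both copies conjugates them, and the
-- new pair slides back to the front.
conjugate-pair : {P : Vec (Arrow m) n} → All Proper P →
  All (λ y → ∀ x → Proper x → x ∷ x ∷ P ~ (y ▹ x) ∷ (y ▹ x) ∷ P) P
conjugate-pair [] = []
conjugate-pair {P = y ∷ P} (y-proper ∷ P-proper) =
  (λ x x-proper → ~-trans (slide x-proper y P)
     (~-trans (braid y-proper x (x ∷ P)) (~-∷ (y ▹ x) (braid y-proper x P)))) ∷
  All.map (λ {z} conj x x-proper → ~-trans (slide x-proper y P)
     (~-trans (~-∷ y (conj x x-proper)) (~-sym (slide (▹-proper z {x} x-proper) y P))))
    (conjugate-pair P-proper)

-- Arrows at the vertex 0 and arrows away from it

up : Arrow m → Arrow (suc m)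
up (u , v) = suc u , suc v

ups : Vec (Arrow m) n → Vec (Arrow (suc m)) n
ups = map up

star : Fin m → Arrow (suc m)
star a = zero , suc a

star-proper : (a : Fin m) → Proper (star a)
star-proper a ()

up-proper : {x : Arrow m} → Proper x → Proper (up x)
up-proper x-proper = x-proper ∘ Finₚ.suc-injective

up-▹-up : (x y : Arrow m) → up x ▹ up y ≡ up (x ▹ y)
up-▹-up (u , v) (w , z) =
  cong₂ _,_ (swap-natural Finₚ.suc-injective u v w) (swap-natural Finₚ.suc-injective u v z)

up-▹-star : (x : Arrow m) (a : Fin m) → up x ▹ star a ≡ star (swap x a)
up-▹-star (u , v) a =
  cong₂ _,_ refl (swap-natural Finₚ.suc-injective u v a)

-- As (0 a)(0 b)(0 a) = (a b), a braid move on two distinct stars leaves only one arrow at 0.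
star-▹-star : {a b : Fin m} → a ≢ b → star a ▹ star b ≡ up (a , b)
star-▹-star {a = a} {b} a≢b =
  cong₂ _,_ (swap-fst zero (suc a)) (swap-other {u = zero} (λ ()) (a≢b ∘ sym ∘ Finₚ.suc-injective))

~-ups : {P P′ : Vec (Arrow m) n} → P ~ P′ → ups P ~ ups P′
~-ups ~-refl        = ~-refl
~-ups (~-sym p)     = ~-sym (~-ups p)
~-ups (~-trans p q) = ~-trans (~-ups p) (~-ups q)
~-ups (~-∷ x p)     = ~-∷ (up x) (~-ups p)
~-ups (flip u v P)  = flip (suc u) (suc v) (ups P)
~-ups (braid {x = x} x-proper y P) = braid≡ (up-proper {x = x} x-proper) (up-▹-up x y) (ups P)

product-ups-zero : (P : Vec (Arrow m) n) → product (ups P) zero ≡ zero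
product-ups-zero []      = refl
product-ups-zero (x ∷ P) = cong (swap (up x)) (product-ups-zero P)

product-ups-suc : (P : Vec (Arrow m) n) → ∀ w → product (ups P) (suc w) ≡ suc (product P w)
product-ups-suc []            w = refl
product-ups-suc ((u , v) ∷ P) w =
  trans (cong (swap (suc u , suc v)) (product-ups-suc P w)) (swap-natural Finₚ.suc-injective u v (product P w))

product-ups-injective : {P P′ : Vec (Arrow m) n} →
  (∀ w → product (ups P) w ≡ product (ups P′) w) → ∀ w → product P w ≡ product P′ w
product-ups-injective {P = P} {P′} eq w = Finₚ.suc-injective
  (trans (sym (product-ups-suc P w)) (trans (eq (suc w)) (product-ups-suc P′ w)))

-- Reachability by moves is an equivalence relation `R` on centres, and conjugating the pair by an
-- arrow of `P` relates the ends of that arrow; `Linked P` applied to `R` reaches every centre.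
move-star-pair : {P : Vec (Arrow m) n} → All Proper P → Linked P → ∀ a b →
                 star a ∷ star a ∷ ups P ~ star b ∷ star b ∷ ups P
move-star-pair {m} {n} {P} P-proper P-linked = P-linked R R-equiv
  (All.map (λ {x} → link x) (Allₚ.map⁻ (conjugate-pair (Allₚ.map⁺ (All.map (λ {x} → up-proper {x = x}) P-proper)))))
  where
  R : Rel (Fin m) 0ℓ
  R a b = star a ∷ star a ∷ ups P ~ star b ∷ star b ∷ ups P
  R-equiv : IsEquivalence R
  R-equiv = record { refl = ~-refl ; sym = ~-sym ; trans = ~-trans }
  link : ∀ x → (∀ y → Proper y → y ∷ y ∷ ups P ~ (up x ▹ y) ∷ (up x ▹ y) ∷ ups P) → R (proj₁ x) (proj₂ x)
  link x@(a , b) conj = subst (λ z → star a ∷ star a ∷ ups P ~ z ∷ z ∷ ups P)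
    (trans (up-▹-star x a) (cong star (swap-fst a b))) (conj (star a) (star-proper a))

-- A block of `k` equal stars in front of the shifted `P`; leaving the total length as an index `n`
-- avoids transport along `k + l`.
data Stars {m l} : ℕ → Fin m → Vec (Arrow m) l → Vec (Arrow (suc m)) n → Set where
  none : ∀ {a P} → Stars 0 a P (ups P)
  more : ∀ {k a P} {P⁺ : Vec (Arrow (suc m)) n} → Stars k a P P⁺ → Stars (suc k) a P (star a ∷ P⁺)

Stars-proper : {a : Fin m} {P : Vec (Arrow m) l} {P⁺ : Vec (Arrow (suc m)) n} → Stars k a P P⁺ → All Proper P⁺ → All Proper P
Stars-proper none       ps       = All.map (λ p → p ∘ cong suc) (Allₚ.map⁻ ps)
Stars-proper (more st) (_ ∷ ps) = Stars-proper st ps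

-- Contracting the vertex 0 onto the centre turns the stars into loops and keeps the other vertices
-- connected.
Stars-linked : {a : Fin m} {P : Vec (Arrow m) l} {P⁺ : Vec (Arrow (suc m)) n} → Stars k a P P⁺ → Linked P⁺ → Linked P
Stars-linked {m} {a = a} {P} st linked R R-equiv links u v =
  linked (λ x y → R (collapse x) (collapse y)) (On.isEquivalence collapse R-equiv) (go st) (suc u) (suc v)
  where
  collapse : Fin (suc m) → Fin m
  collapse zero    = a
  collapse (suc w) = w
  go : ∀ {n k} {P⁺ : Vec (Arrow (suc m)) n} → Stars k a P P⁺ → Links (λ x y → R (collapse x) (collapse y)) P⁺
  go none      = Allₚ.map⁺ links
  go (more st) = IsEquivalence.refl R-equiv ∷ go st

record Normal (P⁺ : Vec (Arrow (suc m)) n) : Set where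
  constructor normal
  field
    {stars size} : ℕ
    {centre}     : Fin m
    {rest}       : Vec (Arrow m) size
    {form}       : Vec (Arrow (suc m)) n
    equiv        : P⁺ ~ form
    shape        : Stars stars centre rest form

∷-Normal : (x : Arrow (suc m)) {P⁺ P′ : Vec (Arrow (suc m)) n} → P⁺ ~ P′ → Normal (x ∷ P′) → Normal (x ∷ P⁺)
∷-Normal x p (normal q st) = normal (~-trans (~-∷ x p) q) st

-- The shifted arrow passes the block by braid moves, which apply `swap x` to the centre of every
-- star, and joins the rest.
sink : {x : Arrow m} {a : Fin m} {P : Vec (Arrow m) l} {P⁺ : Vec (Arrow (suc m)) n} → Proper x → Stars k a P P⁺ → Normal (up x ∷ P⁺)
sink {m = m} {l = l} {x = x} {P = P} x-proper st = normal (proj₁ (proj₂ (go st))) (proj₂ (proj₂ (go st)))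
  where
  go : ∀ {n k a} {P⁺ : Vec (Arrow (suc m)) n} → Stars k a P P⁺ →
       ∃ λ P′ → (up x ∷ P⁺ ~ P′) × Stars k (swap x a) (x ∷ P) P′
  go none = _ , ~-refl , none
  go (more {a = a} {P⁺ = P⁺} st) with go st
  ... | P′ , p , st′ = _ , ~-trans (braid≡ (up-proper {x = x} x-proper) (up-▹-star x a) P⁺) (~-∷ _ p) , more st′

-- A star with another centre turns the first star of the block into an arrow away from 0 and goes
-- on to a shorter block; that arrow is then sunk through the resulting block.
insert-star : (b : Fin m) {a : Fin m} {P : Vec (Arrow m) l} {P⁺ : Vec (Arrow (suc m)) n} → Stars k a P P⁺ → Normal (star b ∷ P⁺)
insert-star b none = normal ~-refl (more none)
insert-star b (more {a = a} {P⁺ = P⁺} st) with b ≟ a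
... | yes refl = normal ~-refl (more (more st))
... | no  b≢a with insert-star b st
...   | normal p st′ with sink {x = b , a} b≢a st′
...     | normal q st″ = normal
            (~-trans (braid≡ (star-proper b) (star-▹-star b≢a) P⁺) (~-trans (~-∷ (up (b , a)) p) q)) st″

normalise : (P⁺ : Vec (Arrow (suc (suc m))) n) → All Proper P⁺ → Normal P⁺
-- An empty block may have any centre; `zero` is available because there are at least two vertices.
normalise [] [] = normal ~-refl (none {a = zero} {P = []})
normalise (x ∷ P⁺) (px ∷ ps) with normalise P⁺ ps
normalise ((zero  , zero)  ∷ P⁺) (px ∷ ps) | normal p st = contradiction refl px
normalise ((zero  , suc b) ∷ P⁺) (px ∷ ps) | normal p st = ∷-Normal (star b) p (insert-star b st)
normalise ((suc a , suc b) ∷ P⁺) (px ∷ ps) | normal p st = ∷-Normal (up (a , b)) p (sink {x = a , b} (px ∘ cong suc) st)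
normalise ((suc b , zero)  ∷ P⁺) (px ∷ ps) | normal p st with ∷-Normal (star b) p (insert-star b st)
... | normal q st′ = normal (~-trans (flip (suc b) zero P⁺) q) st′

another : (a : Fin (suc (suc m))) → ∃ λ b → a ≢ b
another zero    = suc zero , λ ()
another (suc a) = zero , λ ()

-- The moves are (0 a)(0 a)(0 a) → (0 a)(0 b)(0 b) → (a b)(0 a)(0 b) → (a b)(a b)(0 a) → (0 a)(a
-- b)(a b).
three-stars : {P : Vec (Arrow m) n} → All Proper P → Linked P → {a b : Fin m} → a ≢ b →
  star a ∷ star a ∷ star a ∷ ups P ~ star a ∷ ups ((a , b) ∷ (a , b) ∷ P)
three-stars {P = P} P-proper P-linked {a} {b} a≢b =
  ~-trans (~-∷ (star a) (move-star-pair P-proper P-linked a b))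
  (~-trans (braid≡ (star-proper a) (star-▹-star a≢b) (star b ∷ ups P))
  (~-trans (~-∷ (up (a , b)) (braid≡ (star-proper a) (star-▹-star a≢b) (ups P)))
           (slide (up-proper {x = a , b} a≢b) (star a) (ups P))))

data Reduced {m} (a : Fin m) : Vec (Arrow (suc m)) n → Set₁ where
  one : {P⁺ : Vec (Arrow (suc m)) (suc n)} {P : Vec (Arrow m) n} → All Proper P → Linked P →
        P⁺ ~ star a ∷ ups P → Reduced a P⁺
  two : {P⁺ : Vec (Arrow (suc m)) (suc (suc n))} {P : Vec (Arrow m) n} → All Proper P → Linked P →
        P⁺ ~ star a ∷ star a ∷ ups P → Reduced a P⁺

-- Stars are added from the back; whenever a third appears, two of them are traded for arrows away
-- from 0, with the centre kept. The trade takes a second possible centre, hence three vertices.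
reduce-stars : {a : Fin (suc (suc m))} {P : Vec (Arrow (suc (suc m))) l} {P⁺ : Vec _ n} →
  All Proper P → Linked P → Stars (suc k) a P P⁺ → Reduced a P⁺
reduce-stars P-proper P-linked (more none) = one P-proper P-linked ~-refl
reduce-stars {a = a} P-proper P-linked (more st@(more _)) with reduce-stars P-proper P-linked st
... | one P₁-proper P₁-linked p = two P₁-proper P₁-linked (~-∷ (star a) p)
... | two P₁-proper P₁-linked p with another a
...   | b , a≢b = one (a≢b ∷ a≢b ∷ P₁-proper)
          (λ { R R-equiv (_ ∷ _ ∷ links) → P₁-linked R R-equiv links })
          (~-trans (~-∷ (star a) p) (three-stars P₁-proper P₁-linked a≢b))

-- The vertex 0 is isolated: shifted arrows respect the partition into 0 and the rest.
ups-¬linked : (P : Vec (Arrow (suc m)) n) → ¬ Linked (ups P)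
ups-¬linked {m} P linked =
  true≢false (linked (λ u v → isZero u ≡ isZero v) (On.isEquivalence isZero isEquivalence)
    (Allₚ.map⁺ (All.universal (λ _ → refl) P)) zero (suc zero))
  where
  isZero : ∀ {k} → Fin k → Bool
  isZero zero    = true
  isZero (suc _) = false
  true≢false : true ≢ false
  true≢false ()

reduce : (P⁺ : Vec (Arrow (suc (suc (suc m)))) n) → All Proper P⁺ → Linked P⁺ → ∃ λ a → Reduced a P⁺
reduce P⁺ P⁺-proper P⁺-linked with normalise P⁺ P⁺-proper
... | normal {rest = P} p none = contradiction (~⇒linked p P⁺-linked) (ups-¬linked P)
... | normal p st@(more _) with reduce-stars
        (Stars-proper st (proj₁ (~⇒proper p) P⁺-proper)) (Stars-linked st (~⇒linked p P⁺-linked)) st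
...   | one P-proper P-linked q = _ , one P-proper P-linked (~-trans p q)
...   | two P-proper P-linked q = _ , two P-proper P-linked (~-trans p q)

-- After the reduction of the stars the vertex 0 is split off. Up to two vertices are done by hand,
-- since the reduction takes at least three.
hurwitz : ∀ m {n} (P P′ : Vec (Arrow m) n) → All Proper P → Linked P → All Proper P′ → Linked P′ →
          (∀ w → product P w ≡ product P′ w) → P ~ P′
hurwitz 0 [] [] _ _ _ _ _ = ~-refl
hurwitz 0 ((() , _) ∷ _)
hurwitz 1 [] [] _ _ _ _ _ = ~-refl
hurwitz 1 ((zero , zero) ∷ _) _ (px ∷ _) _ _ _ _ = contradiction refl px
-- On two vertices a proper arrow is unique up to reversal, so the sequences match arrow by arrow.
hurwitz 2 P P′ P-proper _ P′-proper _ _ = go P P′ P-proper P′-proper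
  where
  go : ∀ {n} (P P′ : Vec (Arrow 2) n) → All Proper P → All Proper P′ → P ~ P′
  go [] [] _ _ = ~-refl
  go (x ∷ P) (y ∷ P′) (px ∷ ps) (py ∷ ps′) = ~-trans (~-∷ x (go P P′ ps ps′)) (head x y px py)
    where
    head : ∀ x y → Proper x → Proper y → x ∷ P′ ~ y ∷ P′
    head (zero     , suc zero) (zero     , suc zero) _ _ = ~-refl
    head (zero     , suc zero) (suc zero , zero)     _ _ = flip _ _ P′
    head (suc zero , zero)     (zero     , suc zero) _ _ = flip _ _ P′
    head (suc zero , zero)     (suc zero , zero)     _ _ = ~-refl
    head (zero     , zero)     _ px _ = contradiction refl px
    head (suc zero , suc zero) _ px _ = contradiction refl px
    head _ (zero     , zero)     _ py = contradiction refl py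
    head _ (suc zero , suc zero) _ py = contradiction refl py
hurwitz (suc (suc (suc m))) P P′ P-proper P-linked P′-proper P′-linked eq
  with reduce P P-proper P-linked | reduce P′ P′-proper P′-linked
-- With one star the product sends 0 to the centre, so the centres agree and the star cancels.
... | a , one {P = P₁} pp pl p | b , one {P = P₂} qp ql q = ~-trans p (~-trans
        (subst (λ c → star a ∷ ups P₁ ~ star c ∷ ups P₂) a≡b (~-∷ (star a) (~-ups
          (hurwitz (suc (suc m)) P₁ P₂ pp pl qp ql (product-ups-injective {P = P₁} {P₂} λ w →
            swap-injective (star a) (trans (eq′ w) (cong (λ c → swap (star c) (product (ups P₂) w)) (sym a≡b))))))))
        (~-sym q))
  where
  eq′ : ∀ w → product (star a ∷ ups P₁) w ≡ product (star b ∷ ups P₂) w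
  eq′ w = trans (sym (~⇒product p w)) (trans (eq w) (~⇒product q w))
  at-zero : ∀ {n} c (P : Vec (Arrow (suc (suc m))) n) → product (star c ∷ ups P) zero ≡ suc c
  at-zero c P = trans (cong (swap (star c)) (product-ups-zero P)) (swap-fst zero (suc c))
  a≡b : a ≡ b
  a≡b = Finₚ.suc-injective (trans (sym (at-zero a P₁)) (trans (eq′ zero) (at-zero b P₂)))
-- Pairs of stars cancel in the products, so the rests have equal products; the pair is then moved
-- from `a` to `b`.
... | a , two {P = P₁} pp pl p | b , two {P = P₂} qp ql q = ~-trans p (~-trans
        (~-trans (~-∷ (star a) (~-∷ (star a) (~-ups
          (hurwitz (suc (suc m)) P₁ P₂ pp pl qp ql (product-ups-injective {P = P₁} {P₂} eq′)))))
          (move-star-pair qp ql a b))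
        (~-sym q))
  where
  eq′ : ∀ w → product (ups P₁) w ≡ product (ups P₂) w
  eq′ w = trans (sym (swap-involutive (star a) _)) (trans (sym (~⇒product p w)) (trans (eq w)
    (trans (~⇒product q w) (swap-involutive (star b) _))))
-- One star moves the vertex 0 and a pair fixes it, so equal products exclude the mixed cases.
... | a , one {P = P₁} pp pl p | b , two {P = P₂} qp ql q = contradiction
        (trans (sym (trans (cong (swap (star a)) (product-ups-zero P₁)) (swap-fst zero (suc a))))
        (trans (sym (~⇒product p zero)) (trans (eq zero) (trans (~⇒product q zero)
        (trans (swap-involutive (star b) _) (product-ups-zero P₂)))))) λ ()
... | a , two {P = P₁} pp pl p | b , one {P = P₂} qp ql q = contradiction
        (trans (sym (trans (cong (swap (star b)) (product-ups-zero P₂)) (swap-fst zero (suc b))))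
        (trans (sym (~⇒product q zero)) (trans (sym (eq zero)) (trans (~⇒product p zero)
        (trans (swap-involutive (star a) _) (product-ups-zero P₁)))))) λ ()

-- From quivers to sequences of arrows

arrow : Quiver m n → Fin n → Arrow m
arrow Q i = s Q i , t Q i

arrows : Quiver m n → Vec (Arrow m) n
arrows Q = tabulate (arrow Q)

lookup-arrows : (Q : Quiver m n) → ∀ i → lookup (arrows Q) i ≡ arrow Q i
lookup-arrows Q = lookup∘tabulate (arrow Q)

arrows-proper : (Q : Quiver m n) → Loopless Q → All Proper (arrows Q)
arrows-proper Q loopless = Allₚ.tabulate⁺ loopless

arrows-linked : (Q : Quiver m n) → Connected Q → Linked (arrows Q)
arrows-linked Q connected R R-equiv links u v = EqClosure.fold R-equiv adjacent (connected u v)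
  where
  adjacent : ∀ {u v} → Adj Q u v → R u v
  adjacent (i , refl , refl) = Allₚ.tabulate⁻ links i

Inc≐inc : (Q : Quiver m n) → Inc Q ≐ inc (arrows Q)
Inc≐inc Q i j = cong (λ x → root x i) (sym (lookup-arrows Q j))

Gˇ≐uni : (Q : Quiver m n) → Loopless Q → Gˇ Q ≐ uni (arrows Q)
Gˇ≐uni Q loopless i j with i ≟ j
-- Without loops the diagonal of the Gram matrix is 2, and halving it gives 1.
... | yes refl = trans (cong (_/ℕ 2) (∙-self (loopless i))) (sym (uni-diag (arrows Q) i))
... | no  i≢j with i <? j
...   | yes i<j = sym (trans (uni-above (arrows Q) i<j) (cong₂ _∙_ (lookup-arrows Q i) (lookup-arrows Q j)))
...   | no  i≮j = sym (uni-below (arrows Q) (ℕₚ.≤∧≢⇒< (ℕₚ.≮⇒≥ i≮j) (i≢j ∘ sym ∘ Finₚ.toℕ-injective)))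

module _ (Q : Quiver m n) (loopless : Loopless Q) where
  private
    P : Vec (Arrow m) n
    P = arrows Q
    V : Mat n n
    V = unitriInv (Gˇ Q)
    Gˇ≐U : Gˇ Q ≐ uni P
    Gˇ≐U = Gˇ≐uni Q loopless

  Gˇ-inverseʳ : Gˇ Q ⊗ V ≐ Id n
  Gˇ-inverseʳ = ⊗-unitriInv (Gˇ Q)
    (λ i → trans (Gˇ≐U i i) (uni-diag P i)) (λ {i} {j} j<i → trans (Gˇ≐U i j) (uni-below P j<i))

  Gˇ-inverseˡ : V ⊗ Gˇ Q ≐ Id n
  Gˇ-inverseˡ = left⇒right-inverse (Gˇ Q) V Gˇ-inverseʳ

  -- The geometric series `V` and the recursive `W` invert the same matrix, hence agree, and the
  -- formula for `W` gives Λ.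
  Λ-product : ∀ i j → Λ Q i j ≡ Id m i (product P j)
  Λ-product i j = begin
    Id m i j - (Inc Q ⊗ V ⊗ Inc Q ᵀ) i j
      ≡⟨ cong (λ z → Id m i j - z) (trans (I⊗V⊗Iᵀ i j) (inc-W-incᵀ i j)) ⟩
    Id m i j - (Id m i j - Id m i (product P j))
      ≡⟨ cancel (Id m i j) (Id m i (product P j)) ⟩
    Id m i (product P j) ∎
    where
    open ≡-Reasoning
    open Resolvent (resolvent P)
    cancel : ∀ a b → a - (a - b) ≡ b
    cancel = solve-∀
    V≐W : V ≐ W
    V≐W = ≐-sym (inverse-unique {A = uni P} {W} {V} W-inverseˡ (≐-trans (⊗-congʳ V (≐-sym Gˇ≐U)) Gˇ-inverseʳ))
    I⊗V⊗Iᵀ : Inc Q ⊗ V ⊗ Inc Q ᵀ ≐ inc P ⊗ (W ⊗ inc P ᵀ)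
    I⊗V⊗Iᵀ = ≐-trans (⊗-assoc (Inc Q) V (Inc Q ᵀ))
      (⊗-cong (Inc≐inc Q) (⊗-cong V≐W (λ l h → Inc≐inc Q h l)))

-- The three conditions and the implications between them

Dagger-related : (Q Q̃ : Quiver m n) → Set
Dagger-related {n = n} Q Q̃ = Σ (Mat n n) λ B → (Inc Q ⊗ B ≐ Inc Q̃) × (Inc† Q̃ ⊗ (B ᵀ) ≐ Inc† Q)

Strongly-congruent : (Q Q̃ : Quiver m n) → Set
Strongly-congruent Q Q̃ = Congruent (Inc Q) (Gˇ Q) (Inc Q̃) (Gˇ Q̃)

dagger⇒Λ : (Q Q̃ : Quiver m n) → Dagger-related Q Q̃ → Λ Q ≐ Λ Q̃
dagger⇒Λ {m} Q Q̃ (B , IB , I†B) i j = cong (λ z → Id m i j - z) (I†Iᵀ i j)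
  where
  open ≐-Reasoning
  I†Iᵀ : Inc† Q ⊗ Inc Q ᵀ ≐ Inc† Q̃ ⊗ Inc Q̃ ᵀ
  I†Iᵀ = begin
    Inc† Q ⊗ Inc Q ᵀ            ≈⟨ ⊗-congʳ (Inc Q ᵀ) I†B ⟨
    Inc† Q̃ ⊗ B ᵀ ⊗ Inc Q ᵀ      ≈⟨ ⊗-assoc (Inc† Q̃) (B ᵀ) (Inc Q ᵀ) ⟩
    Inc† Q̃ ⊗ (B ᵀ ⊗ Inc Q ᵀ)    ≈⟨ ⊗-congˡ (Inc† Q̃) (⊗-ᵀ (Inc Q) B) ⟨
    Inc† Q̃ ⊗ (Inc Q ⊗ B) ᵀ      ≈⟨ ⊗-congˡ (Inc† Q̃) (λ l h → IB h l) ⟩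
    Inc† Q̃ ⊗ Inc Q̃ ᵀ            ∎

module _ (Q Q̃ : Quiver m n) (loopless : Loopless Q) (loopless~ : Loopless Q̃) where

  -- Substituting I(Q)B for I(Q̃) leaves the factor B Ṽ Bᵀ, which is the inverse of Ǧ_Q.
  strong⇒dagger : Strongly-congruent Q Q̃ → Dagger-related Q Q̃
  strong⇒dagger (B , IB , GB) = B , IB , (begin
    Inc Q̃ ⊗ Ṽ ⊗ B ᵀ          ≈⟨ ⊗-assoc (Inc Q̃) Ṽ (B ᵀ) ⟩
    Inc Q̃ ⊗ (Ṽ ⊗ B ᵀ)        ≈⟨ ⊗-congʳ (Ṽ ⊗ B ᵀ) IB ⟨
    Inc Q ⊗ B ⊗ (Ṽ ⊗ B ᵀ)    ≈⟨ ⊗-assoc (Inc Q) B (Ṽ ⊗ B ᵀ) ⟩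
    Inc Q ⊗ (B ⊗ (Ṽ ⊗ B ᵀ))  ≈⟨ ⊗-congˡ (Inc Q) BṼBᵀ≐V ⟩
    Inc Q ⊗ V ∎)
    where
    open ≐-Reasoning
    V Ṽ : Mat n n
    V = unitriInv (Gˇ Q)
    Ṽ = unitriInv (Gˇ Q̃)
    BṼBᵀ≐V : B ⊗ (Ṽ ⊗ B ᵀ) ≐ V
    BṼBᵀ≐V = inverse-unique {A = Gˇ Q} {B ⊗ (Ṽ ⊗ B ᵀ)} {V}
      (congruence-inverse (Gˇ Q) (Gˇ Q̃) Ṽ B (Gˇ-inverseˡ Q̃ loopless~) GB) (Gˇ-inverseʳ Q loopless)

  Λ⇒strong : Connected Q → Connected Q̃ → Λ Q ≐ Λ Q̃ → Strongly-congruent Q Q̃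
  Λ⇒strong connected connected~ Λ≐Λ = transport (~⇒≅ (hurwitz m (arrows Q) (arrows Q̃)
      (arrows-proper Q loopless) (arrows-linked Q connected)
      (arrows-proper Q̃ loopless~) (arrows-linked Q̃ connected~) same-product))
    where
    -- Column `w` of Λ is the basis vector at the image of `w`, so the image is read off from the
    -- entry 1.
    same-product : ∀ w → product (arrows Q) w ≡ product (arrows Q̃) w
    same-product w = Id-injective (trans (sym (Λ-product Q̃ loopless~ (product (arrows Q) w) w))
      (trans (sym (Λ≐Λ (product (arrows Q) w) w)) (trans (Λ-product Q loopless (product (arrows Q) w) w) (Id-refl _))))
    transport : arrows Q ≅ arrows Q̃ → Strongly-congruent Q Q̃
    transport (B , IB , UB) = B ,
      ≐-trans (⊗-congʳ B (Inc≐inc Q)) (≐-trans IB (≐-sym (Inc≐inc Q̃))) ,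
      ≐-trans (Gˇ≐uni Q̃ loopless~)
        (≐-trans UB (⊗-congʳ B (⊗-congˡ (B ᵀ) (≐-sym (Gˇ≐uni Q loopless)))))

theorem4p1 : ∀ {m n} (Q Q̃ : Quiver m n)
    → Connected Q → Loopless Q → Connected Q̃ → Loopless Q̃
    → ((Λ Q ≐ Λ Q̃) ⇔ (Σ (Mat n n) λ B → (Inc Q ⊗ B ≐ Inc Q̃) × (Inc† Q̃ ⊗ (B ᵀ) ≐ Inc† Q)))
    × ((Λ Q ≐ Λ Q̃) ⇔ (Σ (Mat n n) λ B → (Inc Q ⊗ B ≐ Inc Q̃) × (Gˇ Q̃ ≐ (B ᵀ) ⊗ Gˇ Q ⊗ B)))
theorem4p1 Q Q̃ connected loopless connected~ loopless~ =
  mk⇔ (iii⇒ii ∘ i⇒iii) (dagger⇒Λ Q Q̃) , mk⇔ i⇒iii (dagger⇒Λ Q Q̃ ∘ iii⇒ii)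
  where
  i⇒iii : Λ Q ≐ Λ Q̃ → Strongly-congruent Q Q̃
  i⇒iii = Λ⇒strong Q Q̃ loopless loopless~ connected connected~
  iii⇒ii : Strongly-congruent Q Q̃ → Dagger-related Q Q̃
  iii⇒ii = strong⇒dagger Q Q̃ loopless loopless~
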